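{- Let $d \ge 1$. 1. For every fixed positive integer $t$ and every fixed $d$-dimensional 0-1 matrix $P$ with at least two ones, $$\operatorname{ex}(n, Q_{P,t},d+1) = O\left(\operatorname{ex}(n, P, d)^{1/t}\, n^{d+1-d/t}\right).$$ 2. For every fixed positive integer $t$ and every fixed $d$-dimensional 0-1 matrix $P$ with $\operatorname{ex}(n, P, d) = O(n^{d-1})$, we have $\operatorname{ex}(n, Q_{P,t},d+1) = O(n^{d+1-1/t})$. In particular, $\operatorname{ex}(n, Q_{P,2}, d+1) = \Theta(n^{d+1/2})$ for every $d$-dimensional 0-1 matrix $P$ with at least two ones such that $\operatorname{ex}(n, P, d) = O(n^{d-1})$. Moreover, $\operatorname{ex}(n, Q_{P,3}, d+1) = \Theta(n^{d+2/3})$ for every $d$-dimensional 0-1 matrix $P$ with at least three ones differing in the first coordinate (i.e. having three ones whose first coordinates are pairwise distinct) such that $\operatorname{ex}(n, P, d) = O(n^{d-1})$.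
   Context: A $d$-dimensional 0-1 matrix is a $d$-dimensional array, of some dimensions $n_1\times\cdots\times n_d$, with entries in $\{0,1\}$; it has sidelength $n$ if $n_1=\cdots=n_d=n$. A submatrix is obtained by choosing a subset of the indices in each of the $d$ coordinates (keeping their order). A $d$-dimensional 0-1 matrix $A$ contains a $d$-dimensional 0-1 matrix $B$ if some submatrix of $A$ can be turned into $B$ by changing some number (possibly zero) of ones to zeroes; otherwise $A$ avoids $B$. For a $d$-dimensional 0-1 matrix $Q$, $\operatorname{ex}(n,Q,d)$ is the maximum number of ones in a $d$-dimensional 0-1 matrix of sidelength $n$ that avoids $Q$. For a $d$-dimensional 0-1 matrix $P$ and a positive integer $t$, $Q_{P,t}$ is the $(d+1)$-dimensional 0-1 matrix obtained from $P$ by stacking $t$ copies of $P$ with the same orientation in the direction of the new dimension, i.e. $Q_{P,t}$ has length $t$ in the new coordinate and each of its $t$ slices orthogonal to that direction equals $P$. (For example, if $P$ is the $4\times 1$ all-ones matrix, then $Q_{P,t}$ is the $4\times t$ all-ones matrix.) Asymptotic notation is as $n\to\infty$ with $d$, $t$, $P$ fixed; implied constants may depend on these fixed parameters. -}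

module Defs where

import Algebra.Properties.CommutativeMonoid.Sum
open import Data.Bool.Base using (Bool; true; false; if_then_else_)
import Data.Bool.Base as Bool
import Data.Bool.Properties as Bool
open import Data.Fin.Base using (Fin; zero; suc)
import Data.Fin.Properties as Fin
open import Data.List.Base using (List; []; _∷_; map; filter; cartesianProductWith)
open import Data.List.Extrema.Nat using (max; xs≤max)
import Data.List.Extrema.Nat as Extrema
open import Data.List.Membership.Propositional using (_∈_)
open import Data.List.Membership.Propositional.Properties
  using (∈-map⁺; ∈-map⁻; ∈-filter⁺; ∈-filter⁻; ∈-cartesianProductWith⁺)
open import Data.List.Relation.Unary.Any using (here; there)
import Data.List.Relation.Unary.All as ListAll
open import Data.Nat.Base using (ℕ; zero; suc; _*_; _^_; _≤_)
open import Data.Nat.Properties using (+-0-commutativeMonoid; ≤-trans; ≤-reflexive; n≤0⇒n≡0)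
open import Data.Product.Base using (∃; ∃-syntax; _×_; _,_; proj₂)
open import Data.Sum.Base using (_⊎_; inj₁; inj₂)
open import Data.Vec.Base using (Vec; []; _∷_; _∷ʳ_; head; replicate)
import Data.Vec.Functional as Vector
open import Data.Vec.Relation.Binary.Pointwise.Inductive using (Pointwise; []; _∷_)
open import Data.Vec.Relation.Unary.All using (All; []; _∷_)
open import Function.Base using (_∘_; const)
open import Level using (0ℓ)
open import Relation.Binary.PropositionalEquality
  using (_≡_; _≗_; refl; sym; trans; cong; subst)
open import Relation.Nullary using (¬_; Dec; no; ¬?)
open import Relation.Nullary.Decidable using (map′; _⊎-dec_)
open import Relation.Unary using (Pred; Decidable)

open Algebra.Properties.CommutativeMonoid.Sum +-0-commutativeMonoid
  using (sum; sum-cong-≗) public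

private
  variable
    d k n : ℕ
    ms ns : Vec ℕ d

Index : Vec ℕ d → Set
Index = All Fin

Matrix : Vec ℕ d → Set
Matrix ns = Index ns → Bool

ones : Matrix ns → ℕ
ones {ns = []}     A = if A [] then 1 else 0
ones {ns = n ∷ ns} A = sum {n} λ i → ones λ is → A (i ∷ is)

firstCoordinate : {ns : Vec ℕ (suc d)} → Index ns → Fin (head ns)
firstCoordinate (i ∷ _) = i

-- A term of type Choice k n is a k-element subset of the n indices
-- 0, …, n-1: going through them in order, each is either dropped or kept.

data Choice : ℕ → ℕ → Set where
  done : Choice 0 0
  drop : Choice k n → Choice k (suc n)
  keep : Choice k n → Choice (suc k) (suc n)

-- The chosen indices, in increasing order.

chosen : Choice k n → Fin k → Fin n
chosen (drop c) i       = suc (chosen c i)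
chosen (keep c) zero    = zero
chosen (keep c) (suc i) = suc (chosen c i)

Choices : Vec ℕ d → Vec ℕ d → Set
Choices = Pointwise Choice

chosenIndex : Choices ms ns → Index ms → Index ns
chosenIndex []       []       = []
chosenIndex (c ∷ cs) (i ∷ is) = chosen c i ∷ chosenIndex cs is

submatrix : Choices ms ns → Matrix ns → Matrix ms
submatrix cs A = A ∘ chosenIndex cs

-- The order on Bool is false ≤ true, so B is obtained from the submatrix
-- by changing some ones to zeroes.

_Contains_ : {ms ns : Vec ℕ d} → Matrix ns → Matrix ms → Set
_Contains_ {ms = ms} {ns = ns} A B =
  ∃[ cs ] (∀ is → B is Bool.≤ submatrix {ms = ms} {ns = ns} cs A is)

_Avoids_ : {ms ns : Vec ℕ d} → Matrix ns → Matrix ms → Set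
A Avoids B = ¬ (A Contains B)

anyChoice? : {P : Pred (Choice k n) 0ℓ} → Decidable P → Dec (∃ P)
anyChoice? {zero} {zero} P? =
  map′ (done ,_) (λ { (done , p) → p }) (P? done)
anyChoice? {suc k} {zero} P? = no λ { (() , _) }
anyChoice? {zero} {suc n} P? =
  map′ (λ { (c , p) → drop c , p }) (λ { (drop c , p) → c , p })
       (anyChoice? (P? ∘ drop))
anyChoice? {suc k} {suc n} P? =
  map′ (λ { (inj₁ (c , p)) → drop c , p ; (inj₂ (c , p)) → keep c , p })
       (λ { (drop c , p) → inj₁ (c , p) ; (keep c , p) → inj₂ (c , p) })
       (anyChoice? (P? ∘ drop) ⊎-dec anyChoice? (P? ∘ keep))

anyChoices? : {ms ns : Vec ℕ d} {P : Pred (Choices ms ns) 0ℓ} →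
              Decidable P → Dec (∃ P)
anyChoices? {ms = []} {[]} P? =
  map′ ([] ,_) (λ { ([] , p) → p }) (P? [])
anyChoices? {ms = m ∷ ms} {n ∷ ns} P? =
  map′ (λ { (c , cs , p) → c ∷ cs , p }) (λ { (c ∷ cs , p) → c , cs , p })
       (anyChoice? λ c → anyChoices? λ cs → P? (c ∷ cs))

allIndices? : {P : Pred (Index ns) 0ℓ} → Decidable P → Dec (∀ is → P is)
allIndices? {ns = []} P? = map′ (λ { p [] → p }) (λ p → p []) (P? [])
allIndices? {ns = n ∷ ns} P? =
  map′ (λ { p (i ∷ is) → p i is }) (λ p i is → p (i ∷ is))
       (Fin.all? λ i → allIndices? λ is → P? (i ∷ is))

contains? : {ms ns : Vec ℕ d} (A : Matrix ns) (B : Matrix ms) → Dec (A Contains B)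
contains? A B = anyChoices? λ cs → allIndices? λ is → B is Bool.≤? submatrix cs A is

functions : {X : Set} (n : ℕ) → List X → List (Fin n → X)
functions zero    xs = Vector.[] ∷ []
functions (suc n) xs = cartesianProductWith Vector._∷_ xs (functions n xs)

fromSlices : (Fin n → Matrix ns) → Matrix (n ∷ ns)
fromSlices f (i ∷ is) = f i is

-- All matrices of the given dimensions, each up to pointwise equality.

matrices : (ns : Vec ℕ d) → List (Matrix ns)
matrices []       = const false ∷ const true ∷ []
matrices (n ∷ ns) = map fromSlices (functions n (matrices ns))

-- The value is 0 when no matrix of sidelength n avoids Q; this can only
-- happen when Q has no ones.

ex : {ms : Vec ℕ d} → ℕ → Matrix ms → ℕ
ex {d = d} n Q =
  max 0 (map ones (filter (λ A → ¬? (contains? A Q)) (matrices (replicate d n))))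

functions-complete :
  {X : Set} {_≈_ : X → X → Set} {xs : List X} →
  (∀ x → ∃[ y ] y ∈ xs × x ≈ y) →
  ∀ n (f : Fin n → X) → ∃[ g ] g ∈ functions n xs × (∀ i → f i ≈ g i)
functions-complete full zero    f = Vector.[] , here refl , λ ()
functions-complete full (suc n) f
  with y , y∈ , f0≈y ← full (f zero)
     | g , g∈ , f≈g  ← functions-complete full n (f ∘ suc)
  = y Vector.∷ g , ∈-cartesianProductWith⁺ Vector._∷_ y∈ g∈
  , λ { zero → f0≈y ; (suc i) → f≈g i }

matrices-complete : (ns : Vec ℕ d) (A : Matrix ns) →
                    ∃[ B ] B ∈ matrices ns × A ≗ B
matrices-complete [] A with A [] in eq
... | false = const false , here refl , λ { [] → eq }
... | true  = const true , there (here refl) , λ { [] → eq }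
matrices-complete (n ∷ ns) A
  with g , g∈ , A≗g ← functions-complete {_≈_ = _≗_} (matrices-complete ns) n
                        (λ i is → A (i ∷ is))
  = fromSlices g , ∈-map⁺ fromSlices g∈ , λ { (i ∷ is) → A≗g i is }

ones-cong : {A B : Matrix ns} → A ≗ B → ones A ≡ ones B
ones-cong {ns = []}     A≗B = cong (if_then 1 else 0) (A≗B [])
ones-cong {ns = n ∷ ns} A≗B =
  sum-cong-≗ {n} λ i → ones-cong λ is → A≗B (i ∷ is)

contains-resp : {ms ns : Vec ℕ d} {A A′ : Matrix ns} {B : Matrix ms} →
                A ≗ A′ → A Contains B → A′ Contains B
contains-resp {B = B} A≗A′ (cs , B≤A) =
  cs , λ is → subst (B is Bool.≤_) (A≗A′ (chosenIndex cs is)) (B≤A is)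

ex-upper : {ms : Vec ℕ d} (Q : Matrix ms) (A : Matrix (replicate d n)) →
           A Avoids Q → ones A ≤ ex n Q
ex-upper {d} {n} Q A avoids
  with B , B∈ , A≗B ← matrices-complete (replicate d n) A
  = ≤-trans (≤-reflexive (ones-cong A≗B))
      (ListAll.lookup (xs≤max 0 _)
        (∈-map⁺ ones (∈-filter⁺ (λ M → ¬? (contains? M Q)) B∈
          (avoids ∘ contains-resp (sym ∘ A≗B)))))

ex-attained : {ms : Vec ℕ d} (n : ℕ) (Q : Matrix ms) →
              (∃[ A ] _Avoids_ {ns = replicate d n} A Q) →
              ∃[ A ] _Avoids_ {ns = replicate d n} A Q × ones A ≡ ex n Q
ex-attained {d} n Q (A₀ , avoids₀) = go (Extrema.argmax-sel (λ v → v) 0 values)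
  where
  values : List ℕ
  values = map ones (filter (λ M → ¬? (contains? M Q)) (matrices (replicate d n)))

  go : ex n Q ≡ 0 ⊎ ex n Q ∈ values →
       ∃[ A ] _Avoids_ {ns = replicate d n} A Q × ones A ≡ ex n Q
  go (inj₁ ex≡0) =
    A₀ , avoids₀ ,
    trans (n≤0⇒n≡0 (subst (ones A₀ ≤_) ex≡0 (ex-upper Q A₀ avoids₀))) (sym ex≡0)
  go (inj₂ ex∈) with A , A∈ , ex≡ ← ∈-map⁻ ones ex∈ =
    A ,
    proj₂ (∈-filter⁻ (λ M → ¬? (contains? M Q)) {xs = matrices (replicate d n)} A∈) ,
    sym ex≡

initIndex : (ns : Vec ℕ d) → Index (ns ∷ʳ n) → Index ns
initIndex []       _        = []
initIndex (n ∷ ns) (i ∷ is) = i ∷ initIndex ns is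

stack : {ns : Vec ℕ d} → Matrix ns → (t : ℕ) → Matrix (ns ∷ʳ t)
stack {ns = ns} P t = P ∘ initIndex ns

infix 4 _=O_ _=O[_^1/_] _=Ω[_^1/_] _=Θ[_^1/_]

_=O_ : (ℕ → ℕ) → (ℕ → ℕ) → Set
f =O g = ∃[ C ] ∃[ N ] ∀ n → N ≤ n → f n ≤ C * g n

-- f = O(g^(1/t)), f = Ω(g^(1/t)) and f = Θ(g^(1/t)) for t ≥ 1. The
-- inequalities f n ≤ C (g n)^(1/t) and (g n)^(1/t) ≤ C (f n) between
-- nonnegative reals are written with both sides raised to the power t.

_=O[_^1/_] : (ℕ → ℕ) → (ℕ → ℕ) → ℕ → Set
f =O[ g ^1/ t ] = ∃[ C ] ∃[ N ] ∀ n → N ≤ n → f n ^ t ≤ C ^ t * g n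

_=Ω[_^1/_] : (ℕ → ℕ) → (ℕ → ℕ) → ℕ → Set
f =Ω[ g ^1/ t ] = ∃[ C ] ∃[ N ] ∀ n → N ≤ n → g n ≤ C ^ t * f n ^ t

_=Θ[_^1/_] : (ℕ → ℕ) → (ℕ → ℕ) → ℕ → Set
f =Θ[ g ^1/ t ] = (f =O[ g ^1/ t ]) × (f =Ω[ g ^1/ t ])

{-# OPTIONS --safe #-}
module Submission where

-- Upper bounds (Kővári–Sós–Turán): count pairs of a line of A in the new direction and t ones on it. For a fixed set of
-- t heights the lines that qualify form a d-dimensional matrix avoiding P, so there are at most C(n,t) ex(n,P) pairs;
-- the power mean inequality turns this into a bound on the number of ones.
--
-- Lower bounds: A(z) = M(z_κ, z_last) avoids the stack of t copies of P as soon as P has t ones with distinct κ-th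
-- coordinates and the n × n matrix M contains no t × t all-ones matrix. For t = 2, M is the point-line incidence matrix
-- of the affine plane over F_p; for t = 3 it is a norm graph over F_p, whose rows and columns (A,c), (X,z) in
-- F_p² × F_p^* are incident when c z = N(A − X) for an anisotropic quadratic form N. A prime p with p^t ≍ n comes from
-- a Chebyshev-type argument: an integer U divisible by 1, …, N is divisible by (N/2) C(N,N/2), hence large.

open import Defs
import Algebra.Properties.Semiring.Sum
open import Data.Bool.Base as Bool using (Bool; true; false; if_then_else_; _∧_)
import Data.Bool.Properties as Bool
open import Data.Empty using (⊥; ⊥-elim)
open import Data.Fin.Base as Fin using (Fin; zero; suc; toℕ; fromℕ<; fromℕ; inject₁)
open import Data.Fin.Patterns
open import Data.Fin.Properties as Fin using (toℕ<n; toℕ-fromℕ<; toℕ-injective; pigeonhole; any?)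
open import Data.List.Base using ([]; _∷_)
import Data.List.Extrema.Nat as Extrema
open import Data.List.Membership.Propositional.Properties using (∈-map⁻; ∈-filter⁻)
open import Data.List.Relation.Unary.All using ([]; _∷_) renaming (All to ListAll)
open import Data.Product.Base using (∃-syntax; _×_; _,_; proj₁; proj₂)
open import Data.Sum.Base using (_⊎_; inj₁; inj₂; [_,_]′)
open import Data.Vec.Base using (Vec; []; _∷_; _∷ʳ_; replicate)
open import Data.Vec.Relation.Binary.Pointwise.Inductive using ([]; _∷_)
open import Data.Vec.Relation.Unary.All using ([]; _∷_)
open import Function.Base using (_∘_; id)
open import Relation.Binary.PropositionalEquality
  using (_≡_; _≢_; refl; sym; trans; cong; cong₂; subst; subst₂; module ≡-Reasoning)
open import Relation.Nullary using (¬_; Dec; yes; no; contradiction; does; ¬?)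
open import Relation.Nullary.Decidable using (_×-dec_; dec-true; decidable-stable)

-- For t = 3 the obstacle is to get K_{3,3}-freeness out of a quadratic relation by elementary
-- means. Second differences of c z = N(A - X) are bilinear, so the difference vectors of three rows
-- and those of three columns are orthogonal for a nondegenerate form on F_p³. Two planes orthogonal
-- to each other do not fit into dimension 3, hence three rows or three columns are collinear, and
-- an anisotropic N allows at most two solutions on a line. In the upper bound, t ones per line
-- escape the count and leave an error n^(dt); two ones in P give ex(n,P) ≥ n^(d-1), which absorbs
-- it. A prime within a constant ratio suffices, as the ratio only enters the implied constant. The
-- ratio 8 is chosen so that the primes up to N/8 cost at most 2^(N/4), half of the exponent N/2
-- forced by C(N,N/2); the other half pays for the primes up to √N.

module Summation where

  open import Data.Nat.Base using (ℕ; zero; suc; _+_; _*_; _∸_; _≤_; _<_; z≤n; s≤s)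
  open import Data.Nat.Properties

  private
    variable
      m n : ℕ

  ⟦_⟧ : Bool → ℕ
  ⟦ b ⟧ = if b then 1 else 0

  sum-mono : {f g : Fin n → ℕ} → (∀ i → f i ≤ g i) → sum f ≤ sum g
  sum-mono {zero}  f≤g = z≤n
  sum-mono {suc n} f≤g = +-mono-≤ (f≤g zero) (sum-mono (f≤g ∘ suc))

  Σ< : ℕ → (ℕ → ℕ) → ℕ
  Σ< n f = sum {n} (f ∘ toℕ)

  Σ<-cong : ∀ n {f g : ℕ → ℕ} → (∀ i → f i ≡ g i) → Σ< n f ≡ Σ< n g
  Σ<-cong n f≡g = sum-cong-≗ {n} (f≡g ∘ toℕ)

  Σ<-monoˡ : m ≤ n → ∀ f → Σ< m f ≤ Σ< n f
  Σ<-monoˡ z≤n       f = z≤n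
  Σ<-monoˡ (s≤s m≤n) f = +-monoʳ-≤ (f 0) (Σ<-monoˡ m≤n (f ∘ suc))

  Σ<-+ : ∀ m n f → Σ< (m + n) f ≡ Σ< m f + Σ< n (f ∘ (m +_))
  Σ<-+ zero    n f = refl
  Σ<-+ (suc m) n f = trans (cong (f 0 +_) (Σ<-+ m n (f ∘ suc))) (sym (+-assoc (f 0) _ _))

  -- With `n` = p this splits an index into base-p digits, so counts over numbers below p² or p³
  -- become counts over F_p² or F_p³.
  Σ<-* : ∀ m n f → Σ< (m * n) f ≡ Σ< m λ i → Σ< n λ j → f (i * n + j)
  Σ<-* zero    n f = refl
  Σ<-* (suc m) n f = begin
    Σ< (n + m * n) f                     ≡⟨ Σ<-+ n (m * n) f ⟩
    Σ< n f + Σ< (m * n) (f ∘ (n +_))     ≡⟨ cong (Σ< n f +_) (Σ<-* m n (f ∘ (n +_))) ⟩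
    Σ< n f + (Σ< m λ i → Σ< n λ j → f (n + (i * n + j)))
      ≡⟨ cong (Σ< n f +_) (Σ<-cong m λ i → Σ<-cong n λ j → cong f (sym (+-assoc n (i * n) j))) ⟩
    Σ< n f + (Σ< m λ i → Σ< n λ j → f (n + i * n + j)) ∎
    where open ≡-Reasoning

  const-≤-Σ< : ∀ n {v f} → (∀ i → i < n → v ≤ f i) → n * v ≤ Σ< n f
  const-≤-Σ< zero    v≤f = z≤n
  const-≤-Σ< (suc n) v≤f = +-mono-≤ (v≤f 0 (s≤s z≤n)) (const-≤-Σ< n λ i i<n → v≤f (suc i) (s≤s i<n))

  -- For counts in which one value of a digit may contribute nothing: c = 0, or x = a.
  const-≤-Σ<-except : ∀ n a {v f} → (∀ i → i < n → i ≢ a → v ≤ f i) → (n ∸ 1) * v ≤ Σ< n f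
  const-≤-Σ<-except zero    a v≤f = z≤n
  const-≤-Σ<-except (suc n) zero {v} {f} v≤f =
    ≤-trans (const-≤-Σ< n λ i i<n → v≤f (suc i) (s≤s i<n) λ ()) (m≤n+m _ (f 0))
  const-≤-Σ<-except (suc zero) (suc a) v≤f = z≤n
  const-≤-Σ<-except (suc (suc n)) (suc a) v≤f =
    +-mono-≤ (v≤f 0 (s≤s z≤n) λ ()) (const-≤-Σ<-except (suc n) a λ i i<n i≢a →
      v≤f (suc i) (s≤s i<n) (i≢a ∘ suc-injective))

  single-≤-Σ< : ∀ {n v f} i → i < n → v ≤ f i → v ≤ Σ< n f
  single-≤-Σ< {suc n} {f = f} zero    _         v≤ = ≤-trans v≤ (m≤m+n (f 0) _)
  single-≤-Σ< {suc n} {f = f} (suc i) (s≤s i<n) v≤ = ≤-trans (single-≤-Σ< i i<n v≤) (m≤n+m _ (f 0))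

module IncidenceMatrices where

  open Summation
  open import Data.Integer.Base using (ℤ; +_; _+_; _-_; -_; _*_; 1ℤ; 0ℤ)
  open import Data.Integer.DivMod using (_%ℕ_; _/ℕ_; n%ℕd<d; a≡a%ℕn+[a/ℕn]*n)
  open import Data.Integer.Divisibility.Signed
  import Data.Integer.Properties as ℤ
  open import Data.Integer.Tactic.RingSolver using (solve-∀)
  open import Data.Nat.Base as ℕ using (ℕ; zero; suc; _<_; _≤_; _/_; _%_; _∸_; NonZero; s≤s)
  open import Data.Nat.Coprimality using (prime⇒coprime; coprime-Bézout)
  import Data.Nat.Divisibility as ℕ
  import Data.Nat.DivMod as ℕ
  open import Data.Nat.GCD using (module Bézout)
  open import Data.Nat.Primality using (Prime; euclidsLemma; ¬prime[1]; prime⇒nonZero; prime⇒nonTrivial)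
  import Data.Nat.Properties as ℕ

  -- Linear algebra over F_p on integer representatives

  module Residues (p : ℕ) (p-prime : Prime p) where

    infix 4 _≈0

    -- Elements of F_p are kept as integers and compared modulo p, so polynomial identities can be
    -- left to the ring solver over ℤ.
    _≈0 : ℤ → Set
    x ≈0 = + p ∣ x

    ≈0? : ∀ x → Dec (x ≈0)
    ≈0? x = + p ∣? x

    -- Vanishing is shown by a certificate: `t` as an explicit combination of quantities known to
    -- vanish, which the ring solver checks. A single premise is passed twice, once with coefficient
    -- 0.
    comb₂ : ∀ {t} x y {a b} → a ≈0 → b ≈0 → t ≡ x * a + y * b → t ≈0
    comb₂ x y a≈0 b≈0 t≡ = subst _≈0 (sym t≡) (∣m∣n⇒∣m+n (∣n⇒∣m*n x a≈0) (∣n⇒∣m*n y b≈0))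

    comb₄ : ∀ {t} x y z w {a b c d} → a ≈0 → b ≈0 → c ≈0 → d ≈0 →
            t ≡ x * a + y * b + (z * c + w * d) → t ≈0
    comb₄ x y z w a≈0 b≈0 c≈0 d≈0 t≡ =
      subst _≈0 (sym t≡) (∣m∣n⇒∣m+n (comb₂ x y a≈0 b≈0 refl) (comb₂ z w c≈0 d≈0 refl))

    *-≈0 : ∀ x y → x * y ≈0 → x ≈0 ⊎ y ≈0
    *-≈0 x y xy≈0 with euclidsLemma _ _ p-prime (subst (p ℕ.∣_) (ℤ.abs-* x y) (∣⇒∣ᵤ xy≈0))
    ... | inj₁ p∣x = inj₁ (∣ᵤ⇒∣ p∣x)
    ... | inj₂ p∣y = inj₂ (∣ᵤ⇒∣ p∣y)

    *-≈0-cancelˡ : ∀ x {y} → ¬ (x ≈0) → x * y ≈0 → y ≈0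
    *-≈0-cancelˡ x {y} x≉0 xy≈0 = [ (λ x≈0 → contradiction x≈0 x≉0) , (λ y≈0 → y≈0) ]′ (*-≈0 x y xy≈0)

    -- The components of the cross product, in cyclic order, so that rotating the coordinates only
    -- permutes the fields. Zero vectors are allowed.
    record Parallel (f₁ f₂ f₃ g₁ g₂ g₃ : ℤ) : Set where
      constructor parallel
      field
        minor₂₃ : f₂ * g₃ - f₃ * g₂ ≈0
        minor₃₁ : f₃ * g₁ - f₁ * g₃ ≈0
        minor₁₂ : f₁ * g₂ - f₂ * g₁ ≈0

    -- The premises make f and g multiples of (`k`, `k₂`, `k₃`), as `k` is invertible. The minor
    -- without the first column needs `k` cancelled twice.
    parallel-trans : ∀ k k₂ k₃ f₁ f₂ f₃ g₁ g₂ g₃ → ¬ (k ≈0) →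
      k * f₂ - k₂ * f₁ ≈0 → k * f₃ - k₃ * f₁ ≈0 → k * g₂ - k₂ * g₁ ≈0 → k * g₃ - k₃ * g₁ ≈0 →
      Parallel f₁ f₂ f₃ g₁ g₂ g₃
    parallel-trans k k₂ k₃ f₁ f₂ f₃ g₁ g₂ g₃ k≉0 f∥k₂ f∥k₃ g∥k₂ g∥k₃ =
      parallel
        (*-≈0-cancelˡ k k≉0 (*-≈0-cancelˡ k k≉0
          (comb₄ (k * g₃) (- (k * g₂)) (k₂ * f₁) (- (k₃ * f₁)) f∥k₂ f∥k₃ g∥k₃ g∥k₂
            (lem₁ k k₂ k₃ f₁ f₂ f₃ g₁ g₂ g₃))))
        (*-≈0-cancelˡ k k≉0 (comb₂ g₁ (- f₁) f∥k₃ g∥k₃ (lem₂ k k₃ f₁ f₃ g₁ g₃)))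
        (*-≈0-cancelˡ k k≉0 (comb₂ f₁ (- g₁) g∥k₂ f∥k₂ (lem₃ k k₂ f₁ f₂ g₁ g₂)))
      where
      lem₁ : ∀ k k₂ k₃ f₁ f₂ f₃ g₁ g₂ g₃ → k * (k * (f₂ * g₃ - f₃ * g₂)) ≡
        k * g₃ * (k * f₂ - k₂ * f₁) + (- (k * g₂)) * (k * f₃ - k₃ * f₁) +
        (k₂ * f₁ * (k * g₃ - k₃ * g₁) + (- (k₃ * f₁)) * (k * g₂ - k₂ * g₁))
      lem₁ = solve-∀
      lem₂ : ∀ k k₃ f₁ f₃ g₁ g₃ → k * (f₃ * g₁ - f₁ * g₃) ≡ g₁ * (k * f₃ - k₃ * f₁) + (- f₁) * (k * g₃ - k₃ * g₁)
      lem₂ = solve-∀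
      lem₃ : ∀ k k₂ f₁ f₂ g₁ g₂ → k * (f₁ * g₂ - f₂ * g₁) ≡ f₁ * (k * g₂ - k₂ * g₁) + (- g₁) * (k * f₂ - k₂ * f₁)
      lem₃ = solve-∀

    -- f and g are both orthogonal to m and n, hence multiples of the cross product m × n, whose first entry is nonzero.
    cross-parallel : ∀ m₁ m₂ m₃ n₁ n₂ n₃ f₁ f₂ f₃ g₁ g₂ g₃ →
      m₁ * f₁ + m₂ * f₂ + m₃ * f₃ ≈0 → n₁ * f₁ + n₂ * f₂ + n₃ * f₃ ≈0 →
      m₁ * g₁ + m₂ * g₂ + m₃ * g₃ ≈0 → n₁ * g₁ + n₂ * g₂ + n₃ * g₃ ≈0 →
      ¬ (m₂ * n₃ - m₃ * n₂ ≈0) → Parallel f₁ f₂ f₃ g₁ g₂ g₃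
    cross-parallel m₁ m₂ m₃ n₁ n₂ n₃ f₁ f₂ f₃ g₁ g₂ g₃ mf nf mg ng k≉0 =
      parallel-trans (m₂ * n₃ - m₃ * n₂) (m₃ * n₁ - m₁ * n₃) (m₁ * n₂ - m₂ * n₁) f₁ f₂ f₃ g₁ g₂ g₃ k≉0
        (comb₂ n₃ (- m₃) mf nf (lem m₁ m₂ m₃ n₁ n₂ n₃ f₁ f₂ f₃))
        (comb₂ (- n₂) m₂ mf nf (lem′ m₁ m₂ m₃ n₁ n₂ n₃ f₁ f₂ f₃))
        (comb₂ n₃ (- m₃) mg ng (lem m₁ m₂ m₃ n₁ n₂ n₃ g₁ g₂ g₃))
        (comb₂ (- n₂) m₂ mg ng (lem′ m₁ m₂ m₃ n₁ n₂ n₃ g₁ g₂ g₃))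
      where
      lem : ∀ m₁ m₂ m₃ n₁ n₂ n₃ f₁ f₂ f₃ →
        (m₂ * n₃ - m₃ * n₂) * f₂ - (m₃ * n₁ - m₁ * n₃) * f₁ ≡
        n₃ * (m₁ * f₁ + m₂ * f₂ + m₃ * f₃) + (- m₃) * (n₁ * f₁ + n₂ * f₂ + n₃ * f₃)
      lem = solve-∀
      lem′ : ∀ m₁ m₂ m₃ n₁ n₂ n₃ f₁ f₂ f₃ →
        (m₂ * n₃ - m₃ * n₂) * f₃ - (m₁ * n₂ - m₂ * n₁) * f₁ ≡
        (- n₂) * (m₁ * f₁ + m₂ * f₂ + m₃ * f₃) + m₂ * (n₁ * f₁ + n₂ * f₂ + n₃ * f₃)
      lem′ = solve-∀

    Parallel-rotate : ∀ {f₁ f₂ f₃ g₁ g₂ g₃} → Parallel f₂ f₃ f₁ g₂ g₃ g₁ → Parallel f₁ f₂ f₃ g₁ g₂ g₃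
    Parallel-rotate (parallel m₂₃ m₃₁ m₁₂) = parallel m₁₂ m₂₃ m₃₁

    rotate : ∀ a b c x y z → a * x + b * y + c * z ≈0 → b * y + c * z + a * x ≈0
    rotate a b c x y z = subst _≈0 (eq a b c x y z)
      where
      eq : ∀ a b c x y z → a * x + b * y + c * z ≡ b * y + c * z + a * x
      eq = solve-∀

    rotate² : ∀ a b c x y z → a * x + b * y + c * z ≈0 → c * z + a * x + b * y ≈0
    rotate² a b c x y z h = rotate b c a y z x (rotate a b c x y z h)

    -- Unless m and n are parallel, some component of m × n is nonzero; a cyclic rotation brings it
    -- to the front for `cross-parallel`.
    orthogonal-pairs : ∀ m₁ m₂ m₃ n₁ n₂ n₃ f₁ f₂ f₃ g₁ g₂ g₃ →
      m₁ * f₁ + m₂ * f₂ + m₃ * f₃ ≈0 → n₁ * f₁ + n₂ * f₂ + n₃ * f₃ ≈0 →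
      m₁ * g₁ + m₂ * g₂ + m₃ * g₃ ≈0 → n₁ * g₁ + n₂ * g₂ + n₃ * g₃ ≈0 →
      Parallel m₁ m₂ m₃ n₁ n₂ n₃ ⊎ Parallel f₁ f₂ f₃ g₁ g₂ g₃
    orthogonal-pairs m₁ m₂ m₃ n₁ n₂ n₃ f₁ f₂ f₃ g₁ g₂ g₃ mf nf mg ng =
      cases (≈0? (m₂ * n₃ - m₃ * n₂)) (≈0? (m₃ * n₁ - m₁ * n₃)) (≈0? (m₁ * n₂ - m₂ * n₁))
      where
      cases : Dec (m₂ * n₃ - m₃ * n₂ ≈0) → Dec (m₃ * n₁ - m₁ * n₃ ≈0) → Dec (m₁ * n₂ - m₂ * n₁ ≈0) →
              Parallel m₁ m₂ m₃ n₁ n₂ n₃ ⊎ Parallel f₁ f₂ f₃ g₁ g₂ g₃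
      cases (yes k₁≈0) (yes k₂≈0) (yes k₃≈0) = inj₁ (parallel k₁≈0 k₂≈0 k₃≈0)
      cases (no k₁≉0) _ _ = inj₂ (cross-parallel m₁ m₂ m₃ n₁ n₂ n₃ f₁ f₂ f₃ g₁ g₂ g₃ mf nf mg ng k₁≉0)
      cases _ (no k₂≉0) _ = inj₂ (Parallel-rotate (cross-parallel m₂ m₃ m₁ n₂ n₃ n₁ f₂ f₃ f₁ g₂ g₃ g₁
        (rotate m₁ m₂ m₃ f₁ f₂ f₃ mf) (rotate n₁ n₂ n₃ f₁ f₂ f₃ nf)
        (rotate m₁ m₂ m₃ g₁ g₂ g₃ mg) (rotate n₁ n₂ n₃ g₁ g₂ g₃ ng) k₂≉0))
      cases _ _ (no k₃≉0) = inj₂ (Parallel-rotate (Parallel-rotate (cross-parallel m₃ m₁ m₂ n₃ n₁ n₂ f₃ f₁ f₂ g₃ g₁ g₂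
        (rotate² m₁ m₂ m₃ f₁ f₂ f₃ mf) (rotate² n₁ n₂ n₃ f₁ f₂ f₃ nf)
        (rotate² m₁ m₂ m₃ g₁ g₂ g₃ mg) (rotate² n₁ n₂ n₃ g₁ g₂ g₃ ng) k₃≉0)))

    -- Only the F_p² parts are compared, since N is evaluated on them alone; `distinct` deduces this
    -- from plain inequality of vertices.
    Distinct : ℤ → ℤ → ℤ → ℤ → Set
    Distinct x y x′ y′ = ¬ (x - x′ ≈0 × y - y′ ≈0)

    -- The norm graph contains no K_{3,3}

    module NormGraph (ν : ℤ) (anisotropic : ∀ u v → u * u - ν * (v * v) ≈0 → u ≈0 × v ≈0)
                     (2≉0 : ¬ (+ 2 ≈0)) where

      -- Otherwise (0, 1) would be a nontrivial zero of the form.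
      ν≉0 : ¬ (ν ≈0)
      ν≉0 ν≈0 with anisotropic 0ℤ 1ℤ (comb₂ (- 1ℤ) 0ℤ ν≈0 ν≈0 (lem ν))
        where
        lem : ∀ ν → 0ℤ * 0ℤ - ν * (1ℤ * 1ℤ) ≡ (- 1ℤ) * ν + 0ℤ * ν
        lem = solve-∀
      ... | _ , 1≈0 = contradiction (subst Prime (ℕ.∣1⇒≡1 (∣⇒∣ᵤ 1≈0)) p-prime) ¬prime[1]

      private
        -- Write f₂ = σ f₁, possible because f₁ has an invertible first entry. The last premise
        -- becomes σ (1 - σ) α₁² n = 0, so σ is 0 or 1.
        proportional : ∀ α₁ β₁ α₂ β₂ n → ¬ (α₁ ≈0) → ¬ (n ≈0) → α₁ * β₂ - α₂ * β₁ ≈0 →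
          α₂ * ((α₁ - α₂) * n) ≈0 → (α₂ ≈0 × β₂ ≈0) ⊎ (α₁ - α₂ ≈0 × β₁ - β₂ ≈0)
        proportional α₁ β₁ α₂ β₂ n α₁≉0 n≉0 M h with *-≈0 α₂ _ h
        ... | inj₁ α₂≈0 = inj₁ (α₂≈0 , *-≈0-cancelˡ α₁ α₁≉0 (comb₂ 1ℤ β₁ M α₂≈0 (lem α₁ β₁ α₂ β₂)))
          where
          lem : ∀ α₁ β₁ α₂ β₂ → α₁ * β₂ ≡ 1ℤ * (α₁ * β₂ - α₂ * β₁) + β₁ * α₂
          lem = solve-∀
        ... | inj₂ h′ with *-≈0 (α₁ - α₂) n h′
        ...   | inj₂ n≈0 = contradiction n≈0 n≉0
        ...   | inj₁ α₁≈α₂ = inj₂ (α₁≈α₂ , *-≈0-cancelˡ α₁ α₁≉0 (comb₂ (- 1ℤ) β₁ M α₁≈α₂ (lem α₁ β₁ α₂ β₂)))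
          where
          lem : ∀ α₁ β₁ α₂ β₂ → α₁ * (β₁ - β₂) ≡ (- 1ℤ) * (α₁ * β₂ - α₂ * β₁) + β₁ * (α₁ - α₂)
          lem = solve-∀

      -- On a line a + s f the condition N (a + s f) = c (z + s g) is a quadratic equation in s with leading coefficient
      -- N f ≠ 0, so it cannot have three solutions.
      no-three-collinear : ∀ s t c α₁ β₁ g₁ α₂ β₂ g₂ →
        (s + α₁) * (s + α₁) - ν * ((t + β₁) * (t + β₁)) - (s * s - ν * (t * t)) - c * g₁ ≈0 →
        (s + α₂) * (s + α₂) - ν * ((t + β₂) * (t + β₂)) - (s * s - ν * (t * t)) - c * g₂ ≈0 →
        Parallel α₁ β₁ g₁ α₂ β₂ g₂ →
        ¬ (α₁ ≈0 × β₁ ≈0) → ¬ (α₂ ≈0 × β₂ ≈0) → ¬ (α₁ - α₂ ≈0 × β₁ - β₂ ≈0) → ⊥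
      no-three-collinear s t c α₁ β₁ g₁ α₂ β₂ g₂ E₁ E₂ (parallel M₂₃ M₃₁ M₁₂) f₁≉0 f₂≉0 f₁≉f₂ =
        [ f₂≉0 , f₁≉f₂ ]′ split
        where
        n≉0 : ¬ (α₁ * α₁ - ν * (β₁ * β₁) ≈0)
        n≉0 = f₁≉0 ∘ anisotropic α₁ β₁
        -- With a = (s, t), `E₁` reads 2⟨a, f₁⟩ + N f₁ = c g₁. Since the vectors are parallel, α₂ E₁
        -- - α₁ E₂ removes all linear terms and leaves α₂ N f₁ = α₁ N f₂; `lemB` does the same with
        -- β.
        lemA : ∀ ν s t c α₁ β₁ g₁ α₂ β₂ g₂ →
          α₂ * (α₁ * α₁ - ν * (β₁ * β₁)) - α₁ * (α₂ * α₂ - ν * (β₂ * β₂)) ≡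
          α₂ * (((s + α₁) * (s + α₁) - ν * ((t + β₁) * (t + β₁))) - (s * s - ν * (t * t)) - c * g₁) +
          (- α₁) * (((s + α₂) * (s + α₂) - ν * ((t + β₂) * (t + β₂))) - (s * s - ν * (t * t)) - c * g₂) +
          ((- (+ 2 * ν * t)) * (α₁ * β₂ - β₁ * α₂) + c * (g₁ * α₂ - α₁ * g₂))
        lemA = solve-∀
        A : α₂ * (α₁ * α₁ - ν * (β₁ * β₁)) - α₁ * (α₂ * α₂ - ν * (β₂ * β₂)) ≈0
        A = comb₄ α₂ (- α₁) (- (+ 2 * ν * t)) c E₁ E₂ M₁₂ M₃₁ (lemA ν s t c α₁ β₁ g₁ α₂ β₂ g₂)
        lemB : ∀ ν s t c α₁ β₁ g₁ α₂ β₂ g₂ →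
          β₂ * (α₁ * α₁ - ν * (β₁ * β₁)) - β₁ * (α₂ * α₂ - ν * (β₂ * β₂)) ≡
          β₂ * (((s + α₁) * (s + α₁) - ν * ((t + β₁) * (t + β₁))) - (s * s - ν * (t * t)) - c * g₁) +
          (- β₁) * (((s + α₂) * (s + α₂) - ν * ((t + β₂) * (t + β₂))) - (s * s - ν * (t * t)) - c * g₂) +
          ((- (+ 2 * s)) * (α₁ * β₂ - β₁ * α₂) + (- c) * (β₁ * g₂ - g₁ * β₂))
        lemB = solve-∀
        B : β₂ * (α₁ * α₁ - ν * (β₁ * β₁)) - β₁ * (α₂ * α₂ - ν * (β₂ * β₂)) ≈0
        B = comb₄ β₂ (- β₁) (- (+ 2 * s)) (- c) E₁ E₂ M₁₂ M₂₃ (lemB ν s t c α₁ β₁ g₁ α₂ β₂ g₂)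
        -- Parallel vectors satisfy α₁² N f₂ = α₂² N f₁, so multiplying `A` by α₁ gives the premise
        -- of `proportional`.
        lemA′ : ∀ ν α₁ β₁ α₂ β₂ →
          α₂ * ((α₁ - α₂) * (α₁ * α₁ - ν * (β₁ * β₁))) ≡
          α₁ * (α₂ * (α₁ * α₁ - ν * (β₁ * β₁)) - α₁ * (α₂ * α₂ - ν * (β₂ * β₂))) +
          (- (ν * (α₁ * β₂ + β₁ * α₂))) * (α₁ * β₂ - β₁ * α₂)
        lemA′ = solve-∀
        lemB′ : ∀ ν α₁ β₁ α₂ β₂ →
          β₂ * ((β₁ - β₂) * (α₁ * α₁ - ν * (β₁ * β₁))) ≡
          β₁ * (β₂ * (α₁ * α₁ - ν * (β₁ * β₁)) - β₁ * (α₂ * α₂ - ν * (β₂ * β₂))) +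
          (- (α₁ * β₂ + β₁ * α₂)) * (α₁ * β₂ - β₁ * α₂)
        lemB′ = solve-∀
        swap : ∀ {P Q P′ Q′ : Set} → (P × Q) ⊎ (P′ × Q′) → (Q × P) ⊎ (Q′ × P′)
        swap = λ { (inj₁ (x , y)) → inj₁ (y , x) ; (inj₂ (x , y)) → inj₂ (y , x) }
        comm : ∀ α₁ β₁ α₂ β₂ → α₁ * β₂ - α₂ * β₁ ≡ 1ℤ * (α₁ * β₂ - β₁ * α₂) + 0ℤ * (α₁ * β₂ - β₁ * α₂)
        comm = solve-∀
        comm′ : ∀ α₁ β₁ α₂ β₂ → β₁ * α₂ - β₂ * α₁ ≡ (- 1ℤ) * (α₁ * β₂ - β₁ * α₂) + 0ℤ * (α₁ * β₂ - β₁ * α₂)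
        comm′ = solve-∀
        split : (α₂ ≈0 × β₂ ≈0) ⊎ (α₁ - α₂ ≈0 × β₁ - β₂ ≈0)
        -- Some entry of f₁ is invertible; the second case exchanges the roles of α and β.
        split with ≈0? α₁
        ... | no α₁≉0 = proportional α₁ β₁ α₂ β₂ (α₁ * α₁ - ν * (β₁ * β₁)) α₁≉0 n≉0
                          (comb₂ 1ℤ 0ℤ M₁₂ M₁₂ (comm α₁ β₁ α₂ β₂))
                          (comb₂ α₁ (- (ν * (α₁ * β₂ + β₁ * α₂))) A M₁₂ (lemA′ ν α₁ β₁ α₂ β₂))
        ... | yes α₁≈0 = swap (proportional β₁ α₁ β₂ α₂ (α₁ * α₁ - ν * (β₁ * β₁)) (λ β₁≈0 → f₁≉0 (α₁≈0 , β₁≈0)) n≉0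
                          (comb₂ (- 1ℤ) 0ℤ M₁₂ M₁₂ (comm′ α₁ β₁ α₂ β₂))
                          (comb₂ β₁ (- (α₁ * β₂ + β₁ * α₂)) B M₁₂ (lemB′ ν α₁ β₁ α₂ β₂)))

      -- For ν a nonsquare, u² - ν v² is the norm of u + v √ν, and this is the projective norm graph
      -- N(A + X) = c z with X replaced by -X.
      Incident : ℤ × ℤ × ℤ → ℤ × ℤ × ℤ → Set
      Incident (a , b , c) (x , y , z) = c * z - ((a - x) * (a - x) - ν * ((b - y) * (b - y))) ≈0

      incident-sym : ∀ {a b c x y z} → Incident (a , b , c) (x , y , z) → Incident (x , y , z) (a , b , c)
      incident-sym {a} {b} {c} {x} {y} {z} = subst _≈0 (lem ν a b c x y z)
        where
        lem : ∀ ν a b c x y z → c * z - ((a - x) * (a - x) - ν * ((b - y) * (b - y))) ≡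
                                z * c - ((x - a) * (x - a) - ν * ((y - b) * (y - b)))
        lem = solve-∀

      -- The second difference of c z = N (A - X) is bilinear.
      mixed-difference : ∀ {a b c a₀ b₀ c₀ x y z x₀ y₀ z₀} →
        Incident (a , b , c) (x , y , z) → Incident (a , b , c) (x₀ , y₀ , z₀) →
        Incident (a₀ , b₀ , c₀) (x , y , z) → Incident (a₀ , b₀ , c₀) (x₀ , y₀ , z₀) →
        + 2 * (a - a₀) * (x - x₀) + (- (+ 2 * ν * (b - b₀))) * (y - y₀) + (c - c₀) * (z - z₀) ≈0
      mixed-difference {a} {b} {c} {a₀} {b₀} {c₀} {x} {y} {z} {x₀} {y₀} {z₀} E E′ E″ E‴ =
        comb₄ 1ℤ (- 1ℤ) (- 1ℤ) 1ℤ E E′ E″ E‴ (lem ν a b c a₀ b₀ c₀ x y z x₀ y₀ z₀)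
        where
        lem : ∀ ν a b c a₀ b₀ c₀ x y z x₀ y₀ z₀ →
          + 2 * (a - a₀) * (x - x₀) + (- (+ 2 * ν * (b - b₀))) * (y - y₀) + (c - c₀) * (z - z₀) ≡
          1ℤ * (c * z - ((a - x) * (a - x) - ν * ((b - y) * (b - y)))) +
          (- 1ℤ) * (c * z₀ - ((a - x₀) * (a - x₀) - ν * ((b - y₀) * (b - y₀)))) +
          ((- 1ℤ) * (c₀ * z - ((a₀ - x) * (a₀ - x) - ν * ((b₀ - y) * (b₀ - y)))) +
          1ℤ * (c₀ * z₀ - ((a₀ - x₀) * (a₀ - x₀) - ν * ((b₀ - y₀) * (b₀ - y₀)))))
        lem = solve-∀

      -- Subtracting incidences moves the origin to X₀ - A and leaves the equations of
      -- `no-three-collinear` for the differences of the columns.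
      collinear-columns⇒⊥ : ∀ {a b c x₀ y₀ z₀ x₁ y₁ z₁ x₂ y₂ z₂} →
        Incident (a , b , c) (x₀ , y₀ , z₀) → Incident (a , b , c) (x₁ , y₁ , z₁) →
          Incident (a , b , c) (x₂ , y₂ , z₂) →
        Distinct x₁ y₁ x₀ y₀ → Distinct x₂ y₂ x₀ y₀ → Distinct x₁ y₁ x₂ y₂ →
        Parallel (x₁ - x₀) (y₁ - y₀) (z₁ - z₀) (x₂ - x₀) (y₂ - y₀) (z₂ - z₀) → ⊥
      collinear-columns⇒⊥ {a} {b} {c} {x₀} {y₀} {z₀} {x₁} {y₁} {z₁} {x₂} {y₂} {z₂} E₀ E₁ E₂ d₁₀ d₂₀ d₁₂ par =
        no-three-collinear (x₀ - a) (y₀ - b) c (x₁ - x₀) (y₁ - y₀) (z₁ - z₀) (x₂ - x₀) (y₂ - y₀) (z₂ - z₀)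
          (comb₂ 1ℤ (- 1ℤ) E₀ E₁ (lem ν a b c x₀ y₀ z₀ x₁ y₁ z₁))
            (comb₂ 1ℤ (- 1ℤ) E₀ E₂ (lem ν a b c x₀ y₀ z₀ x₂ y₂ z₂))
          par d₁₀ d₂₀ λ (dx , dy) → d₁₂ (subst _≈0 (lem₂ x₀ x₁ x₂) dx , subst _≈0 (lem₂ y₀ y₁ y₂) dy)
        where
        lem : ∀ ν a b c x₀ y₀ z₀ x y z →
          ((x₀ - a + (x - x₀)) * (x₀ - a + (x - x₀)) - ν * ((y₀ - b + (y - y₀)) * (y₀ - b + (y - y₀)))) -
          ((x₀ - a) * (x₀ - a) - ν * ((y₀ - b) * (y₀ - b))) - c * (z - z₀) ≡
          1ℤ * (c * z₀ - ((a - x₀) * (a - x₀) - ν * ((b - y₀) * (b - y₀)))) +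
          (- 1ℤ) * (c * z - ((a - x) * (a - x) - ν * ((b - y) * (b - y))))
        lem = solve-∀
        lem₂ : ∀ x₀ x₁ x₂ → x₁ - x₀ - (x₂ - x₀) ≡ x₁ - x₂
        lem₂ = solve-∀

      -- The bilinear form of `mixed-difference` is diagonal with entries 2, -2ν, 1. All are
      -- invertible, so scaling by them does not affect collinearity.
      parallel-unscale : ∀ f₁ f₂ f₃ g₁ g₂ g₃ →
        Parallel (+ 2 * f₁) (- (+ 2 * ν * f₂)) f₃ (+ 2 * g₁) (- (+ 2 * ν * g₂)) g₃ → Parallel f₁ f₂ f₃ g₁ g₂ g₃
      parallel-unscale f₁ f₂ f₃ g₁ g₂ g₃ (parallel m₂₃ m₃₁ m₁₂) =
        parallel (2ν-cancel (comb₂ (- 1ℤ) 0ℤ m₂₃ m₂₃ (lem₁ ν f₂ f₃ g₂ g₃)))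
                 (*-≈0-cancelˡ (+ 2) 2≉0 (comb₂ 1ℤ 0ℤ m₃₁ m₃₁ (lem₂ f₁ f₃ g₁ g₃)))
                 (2ν-cancel (*-≈0-cancelˡ (+ 2) 2≉0 (comb₂ (- 1ℤ) 0ℤ m₁₂ m₁₂ (lem₃ ν f₁ f₂ g₁ g₂))))
        where
        2ν-cancel : ∀ {x} → + 2 * (ν * x) ≈0 → x ≈0
        2ν-cancel = *-≈0-cancelˡ ν ν≉0 ∘ *-≈0-cancelˡ (+ 2) 2≉0
        lem₁ : ∀ ν f₂ f₃ g₂ g₃ → + 2 * (ν * (f₂ * g₃ - f₃ * g₂)) ≡
          (- 1ℤ) * ((- (+ 2 * ν * f₂)) * g₃ - f₃ * (- (+ 2 * ν * g₂))) +
          0ℤ * ((- (+ 2 * ν * f₂)) * g₃ - f₃ * (- (+ 2 * ν * g₂)))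
        lem₁ = solve-∀
        lem₂ : ∀ f₁ f₃ g₁ g₃ → + 2 * (f₃ * g₁ - f₁ * g₃) ≡
          1ℤ * (f₃ * (+ 2 * g₁) - + 2 * f₁ * g₃) + 0ℤ * (f₃ * (+ 2 * g₁) - + 2 * f₁ * g₃)
        lem₂ = solve-∀
        lem₃ : ∀ ν f₁ f₂ g₁ g₂ → + 2 * (+ 2 * (ν * (f₁ * g₂ - f₂ * g₁))) ≡
          (- 1ℤ) * (+ 2 * f₁ * (- (+ 2 * ν * g₂)) - (- (+ 2 * ν * f₂)) * (+ 2 * g₁)) +
          0ℤ * (+ 2 * f₁ * (- (+ 2 * ν * g₂)) - (- (+ 2 * ν * f₂)) * (+ 2 * g₁))
        lem₃ = solve-∀

      -- Four mixed differences make two scaled row differences orthogonal to two column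
      -- differences, so three rows or three columns are collinear. The case of the rows is reduced
      -- to that of the columns by the symmetry of incidence.
      K₃₃-free : (a b c x y z : Fin 3 → ℤ) →
        (∀ i j → i ≢ j → Distinct (a i) (b i) (a j) (b j)) →
        (∀ i j → i ≢ j → Distinct (x i) (y i) (x j) (y j)) →
        ¬ (∀ i j → Incident (a i , b i , c i) (x j , y j , z j))
      K₃₃-free a b c x y z rows columns E =
        [ collinear-columns⇒⊥ {x 0F} {y 0F} {z 0F} {a 0F} {b 0F} {c 0F} {a 1F} {b 1F} {c 1F} {a 2F} {b 2F} {c 2F}
            (E′ 0F) (E′ 1F) (E′ 2F) (rows 1F 0F λ ()) (rows 2F 0F λ ()) (rows 1F 2F λ ())
          ∘ parallel-unscale (a 1F - a 0F) (b 1F - b 0F) (c 1F - c 0F) (a 2F - a 0F) (b 2F - b 0F) (c 2F - c 0F)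
        , collinear-columns⇒⊥ {a 0F} {b 0F} {c 0F} {x 0F} {y 0F} {z 0F} {x 1F} {y 1F} {z 1F} {x 2F} {y 2F} {z 2F}
            (E 0F 0F) (E 0F 1F) (E 0F 2F) (columns 1F 0F λ ()) (columns 2F 0F λ ()) (columns 1F 2F λ ()) ]′
        (orthogonal-pairs
          (+ 2 * (a 1F - a 0F)) (- (+ 2 * ν * (b 1F - b 0F))) (c 1F - c 0F)
          (+ 2 * (a 2F - a 0F)) (- (+ 2 * ν * (b 2F - b 0F))) (c 2F - c 0F)
          (x 1F - x 0F) (y 1F - y 0F) (z 1F - z 0F) (x 2F - x 0F) (y 2F - y 0F) (z 2F - z 0F)
          (D 1F 1F) (D 2F 1F) (D 1F 2F) (D 2F 2F))
        where
        E′ : ∀ i → Incident (x 0F , y 0F , z 0F) (a i , b i , c i)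
        E′ i = incident-sym {a i} {b i} {c i} {x 0F} {y 0F} {z 0F} (E i 0F)
        D : ∀ i j → + 2 * (a i - a 0F) * (x j - x 0F) + (- (+ 2 * ν * (b i - b 0F))) * (y j - y 0F)
                    + (c i - c 0F) * (z j - z 0F) ≈0
        D i j = mixed-difference {a i} {b i} {c i} {a 0F} {b 0F} {c 0F} {x j} {y j} {z j} {x 0F} {y 0F} {z 0F}
                  (E i j) (E i 0F) (E 0F j) (E 0F 0F)

  does≡true⇒ : ∀ {A : Set} (a? : Dec A) → does a? ≡ true → A
  does≡true⇒ (yes a) _ = a

  -- Rows and columns are taken by injections in any order, as for K_{t,t} in a bipartite graph, and
  -- `M` lives on all of ℕ so that it can be cut to any sidelength.
  KFree : ℕ → (ℕ → ℕ → Bool) → Set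
  KFree t M = ∀ (rs cs : Fin t → ℕ) → (∀ {i j} → rs i ≡ rs j → i ≡ j) → (∀ {i j} → cs i ≡ cs j → i ≡ j) →
              ¬ (∀ i j → M (rs i) (cs j) ≡ true)

  -- The field F_p: inverses and nonsquares

  module PrimeField (p : ℕ) (p-prime : Prime p) where
    open Residues p p-prime public

    instance
      p≢0 : NonZero p
      p≢0 = prime⇒nonZero p-prime

    1<p : 1 < p
    1<p = ℕ.nonTrivial⇒n>1 p {{prime⇒nonTrivial p-prime}}

    p≈0 : + p ≈0
    p≈0 = ∣-refl

    ≈0⇒∣ : ∀ {n} → + n ≈0 → p ℕ.∣ n
    ≈0⇒∣ = ∣⇒∣ᵤ

    residue≉0 : ∀ {n} → n < p → n ≢ 0 → ¬ (+ n ≈0)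
    residue≉0 {n} n<p n≢0 n≈0 = ℕ.<⇒≱ n<p (ℕ.∣⇒≤ {{ℕ.≢-nonZero n≢0}} (≈0⇒∣ n≈0))

    residue-injective : ∀ {m n} → m < p → n < p → + m - + n ≈0 → m ≡ n
    residue-injective {m} {n} m<p n<p m≈n =
      [ (λ m≤n → half m≤n n<p (comb₂ (- 1ℤ) 0ℤ m≈n m≈n (lem (+ m) (+ n)))) , (λ n≤m → sym (half n≤m m<p m≈n)) ]′
        (ℕ.≤-total m n)
      where
      lem : ∀ m n → n - m ≡ (- 1ℤ) * (m - n) + 0ℤ * (m - n)
      lem = solve-∀
      half : ∀ {m n} → m ≤ n → n < p → + n - + m ≈0 → m ≡ n
      half {m} {n} m≤n n<p n≈m = ℕ.≤-antisym m≤n (ℕ.m∸n≡0⇒m≤n (decidable-stable (n ∸ m ℕ.≟ 0) λ n∸m≢0 →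
        residue≉0 (ℕ.≤-<-trans (ℕ.m∸n≤m n m) n<p) n∸m≢0 (subst _≈0 (trans (ℤ.m-n≡m⊖n n m) (ℤ.⊖-≥ m≤n)) n≈m)))

    residue : ℤ → ℕ
    residue a = a %ℕ p

    residue-< : ∀ a → residue a < p
    residue-< a = n%ℕd<d a p

    residue-≈ : ∀ a → a - + residue a ≈0
    residue-≈ a = subst (λ b → b - + residue a ≈0) (sym (a≡a%ℕn+[a/ℕn]*n a p))
      (subst _≈0 (lem (+ residue a) ((a /ℕ p) * + p)) (∣n⇒∣m*n (a /ℕ p) p≈0))
      where
      lem : ∀ r k → k ≡ r + k - r
      lem = solve-∀

    inverse : ∀ v → ¬ (v ≈0) → ∃[ w ] w * v - 1ℤ ≈0
    inverse v v≉0 = extend (residue-inverse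
      (coprime-Bézout (prime⇒coprime p-prime {{ℕ.≢-nonZero r≢0}} (residue-< v))))
      where
      r : ℕ
      r = residue v
      r≢0 : r ≢ 0
      r≢0 r≡0 = v≉0 (subst _≈0 (trans (cong (λ r → v - + r) r≡0) (ℤ.+-identityʳ v)) (residue-≈ v))
      residue-inverse : Bézout.Identity 1 p r → ∃[ w ] w * + r - 1ℤ ≈0
      residue-inverse (Bézout.+- x y 1+yr≡xp) = - + y ,
        comb₂ (- + x) 0ℤ p≈0 p≈0 (begin
          - + y * + r - 1ℤ             ≡⟨ lem₁ (+ y) (+ r) ⟩
          - (1ℤ + + y * + r)           ≡⟨ cong (λ a → - (1ℤ + a)) (ℤ.pos-* y r) ⟨
          - + (1 ℕ.+ y ℕ.* r)          ≡⟨ cong (-_ ∘ +_) 1+yr≡xp ⟩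
          - + (x ℕ.* p)                ≡⟨ cong -_ (ℤ.pos-* x p) ⟩
          - (+ x * + p)                ≡⟨ lem₂ (+ x) (+ p) ⟩
          - + x * + p + 0ℤ * + p       ∎)
        where
        open ≡-Reasoning
        lem₁ : ∀ y r → - y * r - 1ℤ ≡ - (1ℤ + y * r)
        lem₁ = solve-∀
        lem₂ : ∀ x p → - (x * p) ≡ - x * p + 0ℤ * p
        lem₂ = solve-∀
      residue-inverse (Bézout.-+ x y 1+xp≡yr) = + y ,
        comb₂ (+ x) 0ℤ p≈0 p≈0 (begin
          + y * + r - 1ℤ               ≡⟨ cong (_- 1ℤ) (ℤ.pos-* y r) ⟨
          + (y ℕ.* r) - 1ℤ             ≡⟨ cong (λ a → + a - 1ℤ) 1+xp≡yr ⟨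
          1ℤ + + (x ℕ.* p) - 1ℤ        ≡⟨ cong (λ a → 1ℤ + a - 1ℤ) (ℤ.pos-* x p) ⟩
          1ℤ + + x * + p - 1ℤ          ≡⟨ lem₁ (+ x) (+ p) ⟩
          + x * + p + 0ℤ * + p         ∎)
        where
        open ≡-Reasoning
        lem₁ : ∀ x p → 1ℤ + x * p - 1ℤ ≡ x * p + 0ℤ * p
        lem₁ = solve-∀
      extend : ∃[ w ] w * + r - 1ℤ ≈0 → ∃[ w ] w * v - 1ℤ ≈0
      extend (w , wr≈1) = w , comb₂ 1ℤ w wr≈1 (residue-≈ v) (lem w v (+ r))
        where
        lem : ∀ w v r → w * v - 1ℤ ≡ 1ℤ * (w * r - 1ℤ) + w * (v - r)
        lem = solve-∀

    -- Gives the third digit of a column incident with a given row: z = N(A - X) / c.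
    solveLinear : ∀ c m → ¬ (c ≈0) → ∃[ z ] z < p × c * + z - m ≈0
    solveLinear c m c≉0 = solution (inverse c c≉0)
      where
      lem : ∀ c m w z → c * z - m ≡ m * (w * c - 1ℤ) + (- c) * (w * m - z)
      lem = solve-∀
      solution : ∃[ w ] w * c - 1ℤ ≈0 → ∃[ z ] z < p × c * + z - m ≈0
      solution (w , wc≈1) = residue (w * m) , residue-< (w * m) ,
        comb₂ m (- c) wc≈1 (residue-≈ (w * m)) (lem c m w (+ residue (w * m)))

    -- The root ranges over `Fin p`, which makes the predicate decidable by search.
    IsSquare : ℕ → Set
    IsSquare y = ∃[ x ] + toℕ {p} x * + toℕ x - + y ≈0

    isSquare? : ∀ y → Dec (IsSquare y)
    isSquare? y = any? λ x → ≈0? (+ toℕ x * + toℕ x - + y)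

    -- Since 1 has the two square roots 1 and -1, taking square roots cannot be a function from residues onto residues.
    nonsquare : p ≢ 2 → ∃[ ν ] ¬ IsSquare ν
    nonsquare p≢2 with any? {p} (λ y → ¬? (isSquare? (toℕ y)))
    ... | yes (y , ¬sq) = toℕ y , ¬sq
    ... | no none = ⊥-elim (clash (pigeonhole (ℕ.n<1+n p) h))
      where
      root : (y : Fin p) → IsSquare (toℕ y)
      root y = decidable-stable (isSquare? (toℕ y)) λ ¬sq → none (y , ¬sq)
      g : Fin p → Fin p
      g y = proj₁ (root y)
      root-unique : ∀ {y y′} x → + toℕ {p} x * + toℕ x - + toℕ {p} y ≈0 → + toℕ x * + toℕ x - + toℕ {p} y′ ≈0 → y ≡ y′
      root-unique {y} {y′} x e e′ = toℕ-injective (residue-injective (toℕ<n y) (toℕ<n y′)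
        (comb₂ (- 1ℤ) 1ℤ e e′ (lem (+ toℕ x * + toℕ x) (+ toℕ y) (+ toℕ y′))))
        where
        lem : ∀ s y y′ → y - y′ ≡ (- 1ℤ) * (s - y) + 1ℤ * (s - y′)
        lem = solve-∀
      one minusOne : Fin p
      one      = fromℕ< 1<p
      minusOne = fromℕ< (ℕ.≤-reflexive (ℕ.suc-pred p))
      one≢minusOne : one ≢ minusOne
      one≢minusOne eq = p≢2 (trans (sym (ℕ.suc-pred p))
        (cong suc (trans (sym (toℕ-fromℕ< _)) (trans (cong toℕ (sym eq)) (toℕ-fromℕ< 1<p)))))
      one² : + toℕ one * + toℕ one - + toℕ one ≈0
      one² = subst (λ a → + a * + a - + a ≈0) (sym (toℕ-fromℕ< 1<p)) (comb₂ 0ℤ 0ℤ p≈0 p≈0 refl)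
      pred² : + ℕ.pred p * + ℕ.pred p - 1ℤ ≈0
      pred² = comb₂ (+ ℕ.pred p - 1ℤ) 0ℤ (subst (λ a → + a ≈0) (sym (ℕ.suc-pred p)) p≈0) p≈0 (lem (+ ℕ.pred p) (+ p))
        where
        lem : ∀ q p → q * q - 1ℤ ≡ (q - 1ℤ) * (1ℤ + q) + 0ℤ * p
        lem = solve-∀
      minusOne² : + toℕ minusOne * + toℕ minusOne - + toℕ one ≈0
      minusOne² = subst₂ (λ a b → + a * + a - + b ≈0) (sym (toℕ-fromℕ< (ℕ.≤-reflexive (ℕ.suc-pred p))))
        (sym (toℕ-fromℕ< 1<p)) pred²
      -- Of the roots 1 and -1 of 1, one that `g` does not pick; they differ because p ≠ 2.
      other : ∃[ w ] w ≢ g one × + toℕ w * + toℕ w - + toℕ one ≈0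
      other = choose (g one Fin.≟ one)
        where
        choose : Dec (g one ≡ one) → ∃[ w ] w ≢ g one × + toℕ w * + toℕ w - + toℕ one ≈0
        choose (yes g1≡1) = minusOne , (λ eq → one≢minusOne (sym (trans eq g1≡1))) , minusOne²
        choose (no  g1≢1) = one , (g1≢1 ∘ sym) , one²
      -- `g` is injective, since a root determines its square, and it misses `other`; together they
      -- would embed p + 1 elements into p.
      h : Fin (suc p) → Fin p
      h zero    = proj₁ other
      h (suc y) = g y
      h-injective : ∀ {i j} → i Fin.< j → h i ≢ h j
      h-injective {zero} {suc y} _ w≡gy = proj₁ (proj₂ other)
        (trans w≡gy (cong g (root-unique (proj₁ other)
          (subst (λ x → + toℕ x * + toℕ x - + toℕ y ≈0) (sym w≡gy) (proj₂ (root y))) (proj₂ (proj₂ other)))))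
      h-injective {suc y} {suc y′} (s≤s y<y′) gy≡gy′ =
        Fin.<⇒≢ y<y′ (root-unique (g y) (proj₂ (root y))
          (subst (λ x → + toℕ x * + toℕ x - + toℕ y′ ≈0) (sym gy≡gy′) (proj₂ (root y′))))
      clash : ¬ (∃[ i ] ∃[ j ] i Fin.< j × h i ≡ h j)
      clash (i , j , i<j , eq) = h-injective i<j eq

    -- If v were invertible, ν would be the square of u / v. So v vanishes, and then u² does.
    nonsquare⇒anisotropic : ∀ {ν} → ¬ IsSquare ν → ∀ u v → u * u - + ν * (v * v) ≈0 → u ≈0 × v ≈0
    nonsquare⇒anisotropic {ν} ¬sq u v n≈0 = u≈0 , v≈0
      where
      lem₁ : ∀ ν u v w → u * w * (u * w) - ν ≡ (w * w) * (u * u - ν * (v * v)) + (ν * (w * v + 1ℤ)) * (w * v - 1ℤ)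
      lem₁ = solve-∀
      lem₂ : ∀ ν a x → x * x - ν ≡ 1ℤ * (a * a - ν) + (- (a + x)) * (a - x)
      lem₂ = solve-∀
      square : ∃[ w ] w * v - 1ℤ ≈0 → IsSquare ν
      square (w , wv≈1) =
        fromℕ< (residue-< (u * w)) , subst (λ x → + x * + x - + ν ≈0) (sym (toℕ-fromℕ< (residue-< (u * w))))
          (comb₂ 1ℤ (- (u * w + + residue (u * w)))
            (comb₂ (w * w) (+ ν * (w * v + 1ℤ)) n≈0 wv≈1 (lem₁ (+ ν) u v w)) (residue-≈ (u * w))
            (lem₂ (+ ν) (u * w) (+ residue (u * w))))
      v≈0 : v ≈0
      v≈0 = decidable-stable (≈0? v) (¬sq ∘ square ∘ inverse v)
      lem₃ : ∀ ν u v → u * u ≡ 1ℤ * (u * u - ν * (v * v)) + (ν * v) * v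
      lem₃ = solve-∀
      u≈0 : u ≈0
      u≈0 = [ id , id ]′ (*-≈0 u u (comb₂ 1ℤ (+ ν * v) n≈0 v≈0 (lem₃ (+ ν) u v)))

  [m*n+o]%n≡o : ∀ m {n o} .{{_ : NonZero n}} → o < n → (m ℕ.* n ℕ.+ o) % n ≡ o
  [m*n+o]%n≡o m {n} {o} o<n =
    trans (cong (_% n) (ℕ.+-comm (m ℕ.* n) o)) (trans (ℕ.[m+kn]%n≡m%n o m n) (ℕ.m<n⇒m%n≡m o<n))

  [m*n+o]/n≡m : ∀ m {n o} .{{_ : NonZero n}} → o < n → (m ℕ.* n ℕ.+ o) / n ≡ m
  [m*n+o]/n≡m m {n} {o} o<n = begin
    (m ℕ.* n ℕ.+ o) / n       ≡⟨ ℕ.+-distrib-/-∣ˡ o (ℕ.n∣m*n m) ⟩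
    m ℕ.* n / n ℕ.+ o / n     ≡⟨ cong₂ ℕ._+_ (ℕ.m*n/n≡m m n) (ℕ.m<n⇒m/n≡0 o<n) ⟩
    m ℕ.+ 0                   ≡⟨ ℕ.+-identityʳ m ⟩
    m                         ∎
    where open ≡-Reasoning

  /-%-injective : ∀ {m n} p .{{_ : NonZero p}} → m / p ≡ n / p → m % p ≡ n % p → m ≡ n
  /-%-injective {m} {n} p /≡ %≡ = begin
    m                           ≡⟨ ℕ.m≡m%n+[m/n]*n m p ⟩
    m % p ℕ.+ (m / p) ℕ.* p     ≡⟨ cong₂ (λ r q → r ℕ.+ q ℕ.* p) %≡ /≡ ⟩
    n % p ℕ.+ (n / p) ℕ.* p     ≡⟨ ℕ.m≡m%n+[m/n]*n n p ⟨
    n                           ∎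
    where open ≡-Reasoning

  1≤⟦does⟧ : ∀ {A : Set} (a? : Dec A) → A → 1 ≤ ⟦ does a? ⟧
  1≤⟦does⟧ a? a rewrite dec-true a? a = ℕ.≤-refl

  -- The point-line matrix of the affine plane

  module LineGraph (p : ℕ) (p-prime : Prime p) where
    open PrimeField p p-prime

    -- The number r < p² stands for the line y = (r / p) x + r % p, the number s < p² for the point (s / p, s % p).
    Incidence : ℕ → ℕ → Set
    Incidence r s = r / p < p × s / p < p ×
      + (r / p) * + (s / p) + + (r % p) - + (s % p) ≈0

    incidence? : ∀ r s → Dec (Incidence r s)
    incidence? r s = (r / p ℕ.<? p) ×-dec (s / p ℕ.<? p) ×-dec ≈0? (+ (r / p) * + (s / p) + + (r % p) - + (s % p))

    lineMatrix : ℕ → ℕ → Bool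
    lineMatrix r s = does (incidence? r s)

    -- The mixed difference of the four incidences is (a₀ - a₁)(x₀ - x₁) = 0. Lines of equal slope
    -- through a common point coincide, and so do points of equal abscissa on a common line.
    lineMatrix-KFree : KFree 2 lineMatrix
    lineMatrix-KFree rs cs rs-inj cs-inj all =
      [ (λ a≈ → contradiction (rs-inj {0F} {1F} (rows (residue-injective (r< 0F) (r< 1F) a≈))) λ ())
      , (λ x≈ → contradiction (cs-inj {0F} {1F} (columns (residue-injective (s< 0F) (s< 1F) x≈))) λ ()) ]′
        (*-≈0 _ _ (comb₄ 1ℤ (- 1ℤ) (- 1ℤ) 1ℤ (E 0F 0F) (E 0F 1F) (E 1F 0F) (E 1F 1F)
          (lem (a 0F) (a 1F) (b 0F) (b 1F) (x 0F) (x 1F) (y 0F) (y 1F))))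
      where
      I : ∀ i j → Incidence (rs i) (cs j)
      I i j = does≡true⇒ (incidence? (rs i) (cs j)) (all i j)
      r< : ∀ i → rs i / p < p
      r< i = proj₁ (I i 0F)
      s< : ∀ j → cs j / p < p
      s< j = proj₁ (proj₂ (I 0F j))
      a b x y : Fin 2 → ℤ
      a i = + (rs i / p)
      b i = + (rs i % p)
      x j = + (cs j / p)
      y j = + (cs j % p)
      E : ∀ i j → a i * x j + b i - y j ≈0
      E i j = proj₂ (proj₂ (I i j))
      lem : ∀ a₀ a₁ b₀ b₁ x₀ x₁ y₀ y₁ → (a₀ - a₁) * (x₀ - x₁) ≡
            1ℤ * (a₀ * x₀ + b₀ - y₀) + (- 1ℤ) * (a₀ * x₁ + b₀ - y₁) +
            ((- 1ℤ) * (a₁ * x₀ + b₁ - y₀) + 1ℤ * (a₁ * x₁ + b₁ - y₁))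
      lem = solve-∀
      rows : rs 0F / p ≡ rs 1F / p → rs 0F ≡ rs 1F
      rows a≡ = /-%-injective p a≡ (residue-injective (ℕ.m%n<n (rs 0F) p) (ℕ.m%n<n (rs 1F) p)
        (comb₂ 1ℤ (- 1ℤ) (E 0F 0F) (subst (λ a → + a * x 0F + b 1F - y 0F ≈0) (sym a≡) (E 1F 0F))
          (lem₁ (a 0F * x 0F) (b 0F) (b 1F) (y 0F))))
        where
        lem₁ : ∀ m b₀ b₁ y → b₀ - b₁ ≡ 1ℤ * (m + b₀ - y) + (- 1ℤ) * (m + b₁ - y)
        lem₁ = solve-∀
      columns : cs 0F / p ≡ cs 1F / p → cs 0F ≡ cs 1F
      columns x≡ = /-%-injective p x≡ (residue-injective (ℕ.m%n<n (cs 0F) p) (ℕ.m%n<n (cs 1F) p)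
        (comb₂ (- 1ℤ) 1ℤ (E 0F 0F) (subst (λ x → a 0F * + x + b 0F - y 1F ≈0) (sym x≡) (E 0F 1F))
          (lem₁ (a 0F * x 0F) (b 0F) (y 0F) (y 1F))))
        where
        lem₁ : ∀ m b y₀ y₁ → y₀ - y₁ ≡ (- 1ℤ) * (m + b - y₀) + 1ℤ * (m + b - y₁)
        lem₁ = solve-∀

    -- Each of the p² lines has a point over each of the p abscissas; p² ≤ n keeps them all inside
    -- the n × n square.
    lineMatrix-ones : ∀ n → p ℕ.* p ≤ n →
      p ℕ.* (p ℕ.* (p ℕ.* 1)) ≤ Σ< n λ r → Σ< n λ s → ⟦ lineMatrix r s ⟧
    lineMatrix-ones n p²≤n = ℕ.≤-trans
      (const-≤-Σ< p λ a a<p → const-≤-Σ< p λ b b<p → row a b a<p b<p)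
      (digits≤ λ r → Σ< n λ s → ⟦ lineMatrix r s ⟧)
      where
      digits≤ : ∀ f → (Σ< p λ i → Σ< p λ j → f (i ℕ.* p ℕ.+ j)) ≤ Σ< n f
      digits≤ f = subst (_≤ Σ< n f) (Σ<-* p p f) (Σ<-monoˡ p²≤n f)
      row : ∀ a b → a < p → b < p → p ℕ.* 1 ≤ Σ< n λ s → ⟦ lineMatrix (a ℕ.* p ℕ.+ b) s ⟧
      row a b a<p b<p = ℕ.≤-trans (const-≤-Σ< p λ x x<p → column x x<p) (digits≤ λ s →
        ⟦ lineMatrix (a ℕ.* p ℕ.+ b) s ⟧)
        where
        column : ∀ x → x < p → 1 ≤ Σ< p λ y → ⟦ lineMatrix (a ℕ.* p ℕ.+ b) (x ℕ.* p ℕ.+ y) ⟧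
        column x x<p = single-≤-Σ< {f = λ y → ⟦ lineMatrix (a ℕ.* p ℕ.+ b) (x ℕ.* p ℕ.+ y) ⟧} y y<p
          (1≤⟦does⟧ (incidence? (a ℕ.* p ℕ.+ b) (x ℕ.* p ℕ.+ y))
          ( subst (_< p) (sym ([m*n+o]/n≡m a b<p)) a<p
          , subst (_< p) (sym ([m*n+o]/n≡m x y<p)) x<p
          , subst₂ (λ a x → + a * + x + + ((a₀ ℕ.* p ℕ.+ b) % p) - + ((x₀ ℕ.* p ℕ.+ y) % p) ≈0)
              (sym ([m*n+o]/n≡m a b<p)) (sym ([m*n+o]/n≡m x y<p))
              (subst₂ (λ b y → + a * + x + + b - + y ≈0) (sym ([m*n+o]%n≡o a b<p)) (sym ([m*n+o]%n≡o x y<p))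
                (residue-≈ (+ a * + x + + b)))))
          where
          a₀ x₀ y : ℕ
          a₀ = a
          x₀ = x
          y = residue (+ a * + x + + b)
          y<p : y < p
          y<p = residue-< (+ a * + x + + b)

  -- The norm graph matrix

  module NormMatrix (p : ℕ) (p-prime : Prime p) (p≢2 : p ≢ 2) where
    open PrimeField p p-prime

    ν : ℕ
    ν = proj₁ (nonsquare p≢2)

    anisotropic : ∀ u v → u * u - + ν * (v * v) ≈0 → u ≈0 × v ≈0
    anisotropic = nonsquare⇒anisotropic (proj₂ (nonsquare p≢2))

    2≉0 : ¬ (+ 2 ≈0)
    2≉0 2≈0 = residue≉0 (ℕ.≤∧≢⇒< 1<p (p≢2 ∘ sym)) (λ ()) 2≈0

    open NormGraph (+ ν) anisotropic 2≉0

    high mid low : ℕ → ℕ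
    high r = r / p / p
    mid  r = (r / p) % p
    low  r = r % p

    -- Numbers below p³ stand for points of F_p³ through their digits in base p.
    point : ℕ → ℤ × ℤ × ℤ
    point r = + high r , + mid r , + low r

    -- `high r` < p means r < p³, so this singles out F_p² × F_p^*; indices from p³ on carry no
    -- ones.
    Valid : ℕ → Set
    Valid r = high r < p × low r ≢ 0

    valid? : ∀ r → Dec (Valid r)
    valid? r = (high r ℕ.<? p) ×-dec ¬? (low r ℕ.≟ 0)

    Incidence : ℕ → ℕ → Set
    Incidence r s = Valid r × Valid s × Incident (point r) (point s)

    incidence? : ∀ r s → Dec (Incidence r s)
    incidence? r s = valid? r ×-dec valid? s ×-dec ≈0? _

    normMatrix : ℕ → ℕ → Bool
    normMatrix r s = does (incidence? r s)

    -- If the F_p² parts agreed, a common neighbour (X, z) would give c z = c′ z, and z ≠ 0 cancels.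
    -- This is the reason for restricting to F_p^*.
    distinct : ∀ {r r′ s} → Valid r → Valid r′ → Valid s →
      Incident (point r) (point s) → Incident (point r′) (point s) → r ≢ r′ →
      Distinct (+ high r) (+ mid r) (+ high r′) (+ mid r′)
    distinct {r} {r′} {s} (a<p , _) (a′<p , _) (_ , z≢0) E E′ r≢r′ (a≈ , b≈) =
      r≢r′ (/-%-injective p (/-%-injective p a≡ b≡) c≡)
      where
      a≡ : high r ≡ high r′
      a≡ = residue-injective a<p a′<p a≈
      b≡ : mid r ≡ mid r′
      b≡ = residue-injective (ℕ.m%n<n (r / p) p) (ℕ.m%n<n (r′ / p) p) b≈
      E″ : Incident (+ high r , + mid r , + low r′) (point s)
      E″ = subst₂ (λ a b → Incident (+ a , + b , + low r′) (point s)) (sym a≡) (sym b≡) E′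
      lem : ∀ c c′ z n → z * (c - c′) ≡ 1ℤ * (c * z - n) + (- 1ℤ) * (c′ * z - n)
      lem = solve-∀
      c≡ : low r ≡ low r′
      c≡ = residue-injective (ℕ.m%n<n r p) (ℕ.m%n<n r′ p)
        (*-≈0-cancelˡ (+ low s) (residue≉0 (ℕ.m%n<n s p) z≢0)
          (comb₂ 1ℤ (- 1ℤ) E E″ (lem (+ low r) (+ low r′) (+ low s) _)))

    normMatrix-KFree : KFree 3 normMatrix
    normMatrix-KFree rs cs rs-inj cs-inj all =
      K₃₃-free (+_ ∘ high ∘ rs) (+_ ∘ mid ∘ rs) (+_ ∘ low ∘ rs) (+_ ∘ high ∘ cs) (+_ ∘ mid ∘ cs) (+_ ∘ low ∘ cs)
               rows columns E
      where
      I : ∀ i j → Incidence (rs i) (cs j)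
      I i j = does≡true⇒ (incidence? (rs i) (cs j)) (all i j)
      R : ∀ i → Valid (rs i)
      R i = proj₁ (I i 0F)
      S : ∀ j → Valid (cs j)
      S j = proj₁ (proj₂ (I 0F j))
      E : ∀ i j → Incident (point (rs i)) (point (cs j))
      E i j = proj₂ (proj₂ (I i j))
      rows : ∀ i j → i ≢ j → Distinct (+ high (rs i)) (+ mid (rs i)) (+ high (rs j)) (+ mid (rs j))
      rows i j i≢j = distinct {rs i} {rs j} {cs 0F} (R i) (R j) (S 0F) (E i 0F) (E j 0F) (i≢j ∘ rs-inj)
      E′ : ∀ j → Incident (point (cs j)) (point (rs 0F))
      E′ j = incident-sym {+ high (rs 0F)} {+ mid (rs 0F)} {+ low (rs 0F)}
                          {+ high (cs j)} {+ mid (cs j)} {+ low (cs j)} (E 0F j)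
      columns : ∀ i j → i ≢ j → Distinct (+ high (cs i)) (+ mid (cs i)) (+ high (cs j)) (+ mid (cs j))
      columns i j i≢j = distinct {cs i} {cs j} {rs 0F} (S i) (S j) (R 0F) (E′ i) (E′ j) (i≢j ∘ cs-inj)

    -- There are p² (p - 1) valid rows. Taking x ≠ a makes N(A - X) nonzero, so z = N(A - X) / c is
    -- nonzero as `Valid` demands; this leaves (p - 1) p columns for each row.
    normMatrix-ones : ∀ n → p ℕ.* p ℕ.* p ≤ n →
      p ℕ.* (p ℕ.* ((p ∸ 1) ℕ.* ((p ∸ 1) ℕ.* (p ℕ.* 1)))) ≤ Σ< n λ r → Σ< n λ s → ⟦ normMatrix r s ⟧
    normMatrix-ones n p³≤n = ℕ.≤-trans
      (const-≤-Σ< p λ a a<p → const-≤-Σ< p λ b b<p → const-≤-Σ<-except p 0 λ c c<p c≢0 →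
        row a b c a<p b<p c<p c≢0)
      (digits≤ λ r → Σ< n λ s → ⟦ normMatrix r s ⟧)
      where
      number : ℕ → ℕ → ℕ → ℕ
      number a b c = (a ℕ.* p ℕ.+ b) ℕ.* p ℕ.+ c
      digits≤ : ∀ f → (Σ< p λ a → Σ< p λ b → Σ< p λ c → f (number a b c)) ≤ Σ< n f
      digits≤ f = subst (_≤ Σ< n f)
        (trans (Σ<-* (p ℕ.* p) p f) (Σ<-* p p λ i → Σ< p λ j → f (i ℕ.* p ℕ.+ j)))
        (Σ<-monoˡ p³≤n f)
      module _ {a b c} (a<p : a < p) (b<p : b < p) (c<p : c < p) where
        high≡ : high (number a b c) ≡ a
        high≡ = trans (cong (_/ p) ([m*n+o]/n≡m (a ℕ.* p ℕ.+ b) c<p)) ([m*n+o]/n≡m a b<p)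
        mid≡ : mid (number a b c) ≡ b
        mid≡ = trans (cong (_% p) ([m*n+o]/n≡m (a ℕ.* p ℕ.+ b) c<p)) ([m*n+o]%n≡o a b<p)
        low≡ : low (number a b c) ≡ c
        low≡ = [m*n+o]%n≡o (a ℕ.* p ℕ.+ b) c<p
        point≡ : point (number a b c) ≡ (+ a , + b , + c)
        point≡ = cong₂ (λ a (b , c) → + a , + b , + c) high≡ (cong₂ _,_ mid≡ low≡)
        valid : c ≢ 0 → Valid (number a b c)
        valid c≢0 = subst (_< p) (sym high≡) a<p , c≢0 ∘ trans (sym low≡)
      row : ∀ a b c → a < p → b < p → c < p → c ≢ 0 →
            (p ∸ 1) ℕ.* (p ℕ.* 1) ≤ Σ< n λ s → ⟦ normMatrix (number a b c) s ⟧
      row a b c a<p b<p c<p c≢0 = ℕ.≤-trans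
        (const-≤-Σ<-except p a λ x x<p x≢a → const-≤-Σ< p λ y y<p → column x y x<p y<p x≢a)
        (digits≤ λ s → ⟦ normMatrix (number a b c) s ⟧)
        where
        column : ∀ x y → x < p → y < p → x ≢ a →
          1 ≤ Σ< p λ z → ⟦ normMatrix (number a b c) (number x y z) ⟧
        column x y x<p y<p x≢a = entry (solveLinear (+ c) m (residue≉0 c<p c≢0))
          where
          m : ℤ
          m = (+ a - + x) * (+ a - + x) - + ν * ((+ b - + y) * (+ b - + y))
          m≉0 : ¬ (m ≈0)
          m≉0 m≈0 = x≢a (sym (residue-injective a<p x<p (proj₁ (anisotropic (+ a - + x) (+ b - + y) m≈0))))
          z≢0′ : ∀ {z} → + c * + z - m ≈0 → z ≢ 0
          z≢0′ cz≈m refl = m≉0 (comb₂ (+ c) (- 1ℤ) (comb₂ 0ℤ 0ℤ p≈0 p≈0 refl) cz≈m (lem′ (+ c) m))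
            where
            lem′ : ∀ c m → m ≡ c * 0ℤ + (- 1ℤ) * (c * + 0 - m)
            lem′ = solve-∀
          entry : ∃[ z ] z < p × + c * + z - m ≈0 → 1 ≤ Σ< p λ z → ⟦ normMatrix (number a b c) (number x y z) ⟧
          entry (z , z<p , cz≈m) = single-≤-Σ< {f = λ z → ⟦ normMatrix (number a b c) (number x y z) ⟧} z z<p
            (1≤⟦does⟧ (incidence? (number a b c) (number x y z))
            ( valid a<p b<p c<p c≢0
            , valid x<p y<p z<p (z≢0′ cz≈m)
            , subst₂ Incident (sym (point≡ a<p b<p c<p)) (sym (point≡ x<p y<p z<p)) cz≈m))

open Summation
open IncidenceMatrices using (KFree; module LineGraph; module NormMatrix)
open import Data.Nat.Base
open import Data.Nat.Combinatorics
  using (_C_; nC1≡n; nCk+nC[k+1]≡[n+1]C[k+1]; k>n⇒nCk≡0; nCk≡n!/k![n-k]!; k![n∸k]!∣n!)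
open import Data.Nat.Coprimality using (Coprime; coprime-divisor)
open import Data.Nat.Divisibility
open import Data.Nat.DivMod using (m/n*n≡m)
open import Data.Nat.ListAction using (product)
open import Data.Nat.Primality
open import Data.Nat.Primality.Factorisation using (factorise; module PrimeFactorisation)
open import Data.Nat.Properties
open import Data.Nat.Tactic.RingSolver using (solve-∀)
open Algebra.Properties.Semiring.Sum +-*-semiring using (*-distribˡ-sum; ∑-distrib-+)

private
  variable
    d k n : ℕ
    ms ns : Vec ℕ d

-- Primes between N/8 and N, for N a power of 4

[k+1]*[n+1]C[k+1]≡[n+1]*nCk : ∀ n k → suc k * (suc n C suc k) ≡ suc n * (n C k)
[k+1]*[n+1]C[k+1]≡[n+1]*nCk zero zero = refl
[k+1]*[n+1]C[k+1]≡[n+1]*nCk zero (suc k)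
  rewrite k>n⇒nCk≡0 {1} {suc (suc k)} (s≤s (s≤s z≤n))
        | k>n⇒nCk≡0 {0} {suc k} (s≤s z≤n) = *-zeroʳ (2 + k)
[k+1]*[n+1]C[k+1]≡[n+1]*nCk (suc n) zero = trans (*-identityˡ _) (trans (nC1≡n (2 + n)) (sym (*-identityʳ _)))
[k+1]*[n+1]C[k+1]≡[n+1]*nCk (suc n) (suc k) = begin
  (2 + k) * (suc (suc n) C suc (suc k))
    ≡⟨ cong ((2 + k) *_) (nCk+nC[k+1]≡[n+1]C[k+1] (suc n) (suc k)) ⟨
  (2 + k) * (a + (suc n C suc (suc k)))
    ≡⟨ lem k a (suc n C suc (suc k)) ⟩
  a + (suc k * a + (2 + k) * (suc n C suc (suc k)))
    ≡⟨ cong₂ (λ u v → a + (u + v)) ([k+1]*[n+1]C[k+1]≡[n+1]*nCk n k) ([k+1]*[n+1]C[k+1]≡[n+1]*nCk n (suc k)) ⟩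
  a + (suc n * (n C k) + suc n * (n C suc k))
    ≡⟨ cong (a +_) (*-distribˡ-+ (suc n) (n C k) (n C suc k)) ⟨
  a + suc n * (n C k + n C suc k)
    ≡⟨ cong (λ u → a + suc n * u) (nCk+nC[k+1]≡[n+1]C[k+1] n k) ⟩
  (2 + n) * a ∎
  where
  open ≡-Reasoning
  a = suc n C suc k
  lem : ∀ k a b → (2 + k) * (a + b) ≡ a + (suc k * a + (2 + k) * b)
  lem = solve-∀

-- Leibniz's harmonic triangle: 1 / ((k+1) C(n,k+1)) is obtained from
-- 1/1, …, 1/n by repeated subtraction.
leibniz-step : ∀ {X Y Z D L} .{{_ : NonZero L}} → Y ≡ X + D → Z * D ≡ X * Y → X ∣ L → Y ∣ L → Z ∣ L
leibniz-step {X} {Y} {Z} {D} {L} Y≡X+D ZD≡XY (divides α L≡αX) (divides β L≡βY) =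
  -- 1/Z = 1/X - 1/Y, so L/Z is the difference of α = L/X and β = L/Y.
  divides (α ∸ β) (*-cancelʳ-≡ _ _ X (sym (begin
    (α ∸ β) * Z * X       ≡⟨ lem (α ∸ β) Z X ⟩
    Z * ((α ∸ β) * X)     ≡⟨ cong (Z *_) (*-distribʳ-∸ X α β) ⟩
    Z * (α * X ∸ β * X)   ≡⟨ cong (λ u → Z * (u ∸ β * X))
      (trans (sym L≡αX) (trans L≡βY (trans (cong (β *_) Y≡X+D) (*-distribˡ-+ β X D)))) ⟩
    Z * (β * X + β * D ∸ β * X) ≡⟨ cong (Z *_) (m+n∸m≡n (β * X) (β * D)) ⟩
    Z * (β * D)           ≡⟨ lem₂ Z β D ⟩
    β * (Z * D)           ≡⟨ cong (β *_) ZD≡XY ⟩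
    β * (X * Y)           ≡⟨ lem₃ β X Y ⟩
    β * Y * X             ≡⟨ cong (_* X) L≡βY ⟨
    L * X                 ∎)))
  where
  open ≡-Reasoning
  lem : ∀ a b c → a * b * c ≡ b * (a * c)
  lem = solve-∀
  lem₂ : ∀ a b c → a * (b * c) ≡ b * (a * c)
  lem₂ = solve-∀
  lem₃ : ∀ a b c → a * (b * c) ≡ a * c * b
  lem₃ = solve-∀
  instance
    X≢0 : NonZero X
    X≢0 = ≢-nonZero λ { refl → ≢-nonZero⁻¹ L (trans L≡αX (*-zeroʳ α)) }

[k+1]*nC[k+1]∣L : ∀ {L} .{{_ : NonZero L}} n → (∀ i → 1 ≤ i → i ≤ n → i ∣ L) →
                  ∀ k → k < n → suc k * (n C suc k) ∣ L
[k+1]*nC[k+1]∣L {L} (suc n) all∣L zero _ =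
  subst (_∣ L) (sym (trans (*-identityˡ _) (nC1≡n (suc n)))) (all∣L (suc n) (s≤s z≤n) ≤-refl)
[k+1]*nC[k+1]∣L {L} (suc n) all∣L (suc k) (s≤s k<n) =
  -- Recurrence of the triangle: 1/((k+2) C(n+1,k+2)) = 1/((k+1) C(n,k+1)) - 1/((k+1) C(n+1,k+1)).
  leibniz-step {D = suc k * u} eq₁ eq₂
    ([k+1]*nC[k+1]∣L n (λ i 1≤i i≤n → all∣L i 1≤i (m≤n⇒m≤1+n i≤n)) k k<n)
    ([k+1]*nC[k+1]∣L (suc n) all∣L k (m≤n⇒m≤1+n k<n))
  where
  open ≡-Reasoning
  u v : ℕ
  u = n C k
  v = n C suc k
  eq₁ : suc k * (suc n C suc k) ≡ suc k * v + suc k * u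
  eq₁ = begin
    suc k * (suc n C suc k) ≡⟨ cong (suc k *_) (trans (sym (nCk+nC[k+1]≡[n+1]C[k+1] n k)) (+-comm u v)) ⟩
    suc k * (v + u)         ≡⟨ *-distribˡ-+ (suc k) v u ⟩
    suc k * v + suc k * u   ∎
  eq₂ : (2 + k) * (suc n C suc (suc k)) * (suc k * u) ≡ suc k * v * (suc k * (suc n C suc k))
  eq₂ = begin
    (2 + k) * (suc n C suc (suc k)) * (suc k * u) ≡⟨ cong (_* (suc k * u)) ([k+1]*[n+1]C[k+1]≡[n+1]*nCk n (suc k)) ⟩
    suc n * v * (suc k * u)                   ≡⟨ lem (suc n) v (suc k) u ⟩
    suc k * v * (suc n * u)                   ≡⟨ cong (suc k * v *_) ([k+1]*[n+1]C[k+1]≡[n+1]*nCk n k) ⟨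
    suc k * v * (suc k * (suc n C suc k))     ∎
    where
    lem : ∀ a b c d → a * b * (c * d) ≡ c * b * (a * d)
    lem = solve-∀

nCk≤2^n : ∀ n k → n C k ≤ 2 ^ n
nCk≤2^n zero zero = ≤-refl
nCk≤2^n zero (suc k) rewrite k>n⇒nCk≡0 {0} {suc k} (s≤s z≤n) = z≤n
nCk≤2^n (suc n) zero = m^n>0 2 (suc n)
nCk≤2^n (suc n) (suc k) = begin
  suc n C suc k     ≡⟨ nCk+nC[k+1]≡[n+1]C[k+1] n k ⟨
  n C k + n C suc k ≤⟨ +-mono-≤ (nCk≤2^n n k) (nCk≤2^n n (suc k)) ⟩
  2 ^ n + 2 ^ n     ≡⟨ cong (2 ^ n +_) (+-identityʳ (2 ^ n)) ⟨
  2 ^ suc n         ∎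
  where open ≤-Reasoning

-- A step in `i` multiplies the coefficient by (h+i+1)/(i+1), which is at least 2 while i < h.
2^i≤[h+i]Ci : ∀ h i → i ≤ h → 2 ^ i ≤ (h + i) C i
2^i≤[h+i]Ci h zero _ = ≤-refl
2^i≤[h+i]Ci h (suc i) i<h = *-cancelˡ-≤ (suc i) (begin
  suc i * (2 * 2 ^ i)             ≡⟨ lem (suc i) (2 ^ i) ⟩
  (suc i + suc i) * 2 ^ i         ≤⟨ *-mono-≤ (+-monoˡ-≤ (suc i) i<h) (2^i≤[h+i]Ci h i (<⇒≤ i<h)) ⟩
  (h + suc i) * ((h + i) C i)       ≡⟨ cong (_* ((h + i) C i)) (+-suc h i) ⟩
  suc (h + i) * ((h + i) C i)       ≡⟨ [k+1]*[n+1]C[k+1]≡[n+1]*nCk (h + i) i ⟨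
  suc i * (suc (h + i) C suc i)   ≡⟨ cong (λ m → suc i * (m C suc i)) (+-suc h i) ⟨
  suc i * ((h + suc i) C suc i)     ∎)
  where
  open ≤-Reasoning
  lem : ∀ a b → a * (2 * b) ≡ (a + a) * b
  lem = solve-∀

prime∣n!⇒≤ : ∀ {p} → Prime p → ∀ n → p ∣ n ! → p ≤ n
prime∣n!⇒≤ pr zero p∣1 = contradiction (subst Prime (∣1⇒≡1 p∣1) pr) ¬prime[1]
prime∣n!⇒≤ pr (suc n) p∣ with euclidsLemma (suc n) (n !) pr p∣
... | inj₁ p∣1+n = ∣⇒≤ p∣1+n
... | inj₂ p∣n!  = m≤n⇒m≤1+n (prime∣n!⇒≤ pr n p∣n!)

m∣n! : ∀ {m n} .{{_ : NonZero m}} → m ≤ n → m ∣ n !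
m∣n! {suc m} m≤n = ∣-trans (m∣m*n (m !)) (m≤n⇒m!∣n! m≤n)

-- p divides (2h)! = C(2h,h) · h! · h! but not h!.
prime∣[2h]Ch : ∀ {p} h → Prime p → h < p → p ≤ h + h → p ∣ (h + h) C h
prime∣[2h]Ch {p} h pr h<p p≤2h
  with euclidsLemma ((h + h) C h) (h ! * h !) pr
         (subst (p ∣_) (sym 2h!≡) (m∣n! {{prime⇒nonZero pr}} p≤2h))
  where
  instance
    _ = h !* h !≢0
    _ = h !* (h + h ∸ h) !≢0
  h≤2h = m≤m+n h h
  2h!≡ : ((h + h) C h) * (h ! * h !) ≡ (h + h) !
  2h!≡ = begin
    ((h + h) C h) * (h ! * h !) ≡⟨ cong (λ k → ((h + h) C h) * (h ! * k !)) (m+n∸n≡m h h) ⟨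
    ((h + h) C h) * (h ! * (h + h ∸ h) !) ≡⟨ cong (_* (h ! * (h + h ∸ h) !)) (nCk≡n!/k![n-k]! h≤2h) ⟩
    (h + h) ! / (h ! * (h + h ∸ h) !) * (h ! * (h + h ∸ h) !) ≡⟨ m/n*n≡m (k![n∸k]!∣n! h≤2h) ⟩
    (h + h) ! ∎
    where open ≡-Reasoning
... | inj₁ p∣C = p∣C
... | inj₂ p∣h!h! = contradiction ([ prime∣n!⇒≤ pr h , prime∣n!⇒≤ pr h ]′ (euclidsLemma (h !) (h !) pr p∣h!h!))
  (<⇒≱ h<p)

prime∣prime^⇒≡ : ∀ {p q} → Prime p → Prime q → ∀ e → p ∣ q ^ e → p ≡ q
prime∣prime^⇒≡ pp pq zero p∣1 = contradiction (subst Prime (∣1⇒≡1 p∣1) pp) ¬prime[1]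
prime∣prime^⇒≡ {p} {q} pp pq (suc e) p∣ with euclidsLemma q (q ^ e) pp p∣
... | inj₂ p∣q^e = prime∣prime^⇒≡ pp pq e p∣q^e
... | inj₁ p∣q with prime⇒irreducible pq p∣q
...   | inj₁ p≡1 = contradiction (subst Prime p≡1 pp) ¬prime[1]
...   | inj₂ p≡q = p≡q

prime^-coprime : ∀ {p q} → Prime p → Prime q → p ≢ q → ∀ e → Coprime (q ^ e) p
prime^-coprime pp pq p≢q e (d∣q^e , d∣p) with prime⇒irreducible pp d∣p
... | inj₁ d≡1 = d≡1
... | inj₂ refl = contradiction (prime∣prime^⇒≡ pp pq e d∣q^e) p≢q

-- Split a prime p off the factorisation and write U = p U₁. Prime powers in the remaining product
-- still divide U₁: those of p because one more copy of p was available, the others by coprimality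
-- to p.
primePowers∣⇒∣ : ∀ {k} .{{_ : NonZero k}} U →
  (∀ q e → Prime q → q ^ e ∣ k → q ^ e ∣ U) → k ∣ U
primePowers∣⇒∣ {k} U powers =
  subst (_∣ U) (sym isFactorisation)
    (go factors factorsPrime U λ q e pq q^e∣ → powers q e pq (subst (q ^ e ∣_) (sym isFactorisation) q^e∣))
  where
  open PrimeFactorisation (factorise k)
  go : ∀ ps → ListAll Prime ps → ∀ U → (∀ q e → Prime q → q ^ e ∣ product ps → q ^ e ∣ U) → product ps ∣ U
  go [] _ U _ = 1∣ U
  go (p ∷ ps) (pp ∷ pps) U powers
    with powers p 1 pp (subst (_∣ p * product ps) (sym (*-identityʳ p)) (m∣m*n (product ps)))
  ... | divides U₁ refl =
    subst (p * product ps ∣_) U-eq (*-monoʳ-∣ p (go ps pps U₁ powers₁))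
    where
    instance _ = prime⇒nonZero pp
    U-eq : p * U₁ ≡ U₁ * (p * 1)
    U-eq = trans (*-comm p U₁) (cong (U₁ *_) (sym (*-identityʳ p)))
    powers₁ : ∀ q e → Prime q → q ^ e ∣ product ps → q ^ e ∣ U₁
    powers₁ q e pq q^e∣ with p ≟ q
    ... | yes refl = *-cancelˡ-∣ p (subst (p * p ^ e ∣_) (sym U-eq) (powers p (suc e) pp (*-monoʳ-∣ p q^e∣)))
    ... | no p≢q = coprime-divisor (prime^-coprime pp pq p≢q e)
                     (subst (q ^ e ∣_) (sym U-eq) (powers q e pq (∣n⇒∣m*n p q^e∣)))

-- Every prime p with 1 < p ≤ 2^j divides one of these central binomial coefficients, the one with 2^i < p ≤ 2^(i+1).
centralProduct : ℕ → ℕ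
centralProduct zero    = 1
centralProduct (suc j) = ((2 ^ j + 2 ^ j) C 2 ^ j) * centralProduct j

2^1+j≡ : ∀ j → 2 ^ suc j ≡ 2 ^ j + 2 ^ j
2^1+j≡ j = cong (2 ^ j +_) (+-identityʳ (2 ^ j))

prime∣centralProduct : ∀ {p} j → Prime p → p ≤ 2 ^ j → p ∣ centralProduct j
prime∣centralProduct {p} zero pr p≤1 = contradiction p≤1 (<⇒≱ (nonTrivial⇒n>1 p {{prime⇒nonTrivial pr}}))
prime∣centralProduct {p} (suc j) pr p≤ with p ≤? 2 ^ j
... | yes p≤2^j = ∣n⇒∣m*n ((2 ^ j + 2 ^ j) C 2 ^ j) (prime∣centralProduct j pr p≤2^j)
... | no  p≰2^j = ∣m⇒∣m*n _ (prime∣[2h]Ch (2 ^ j) pr (≰⇒> p≰2^j) (subst (p ≤_) (2^1+j≡ j) p≤))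

-- The factors are at most 2^(2^(i+1)) for i < j, and these exponents add up to 2^(j+1) - 2.
centralProduct-≤ : ∀ j → centralProduct j ≤ 2 ^ 2 ^ suc j
centralProduct-≤ zero = s≤s z≤n
centralProduct-≤ (suc j) = begin
  ((2 ^ j + 2 ^ j) C 2 ^ j) * centralProduct j  ≤⟨ *-mono-≤ (nCk≤2^n (2 ^ j + 2 ^ j) (2 ^ j)) (centralProduct-≤ j) ⟩
  2 ^ (2 ^ j + 2 ^ j) * 2 ^ 2 ^ suc j         ≡⟨ cong (λ e → 2 ^ e * 2 ^ 2 ^ suc j) (2^1+j≡ j) ⟨
  2 ^ 2 ^ suc j * 2 ^ 2 ^ suc j               ≡⟨ ^-distribˡ-+-* 2 (2 ^ suc j) (2 ^ suc j) ⟨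
  2 ^ (2 ^ suc j + 2 ^ suc j)                 ≡⟨ cong (2 ^_) (2^1+j≡ (suc j)) ⟨
  2 ^ 2 ^ suc (suc j)                         ∎
  where open ≤-Reasoning

centralProduct-nonZero : ∀ j → NonZero (centralProduct j)
centralProduct-nonZero zero = _
centralProduct-nonZero (suc j) =
  m*n≢0 _ _ {{>-nonZero (≤-trans (m^n>0 2 (2 ^ j))
    (2^i≤[h+i]Ci (2 ^ j) (2 ^ j) ≤-refl))}} {{centralProduct-nonZero j}}

n!≤n^n : ∀ n → n ! ≤ n ^ n
n!≤n^n n = go n ≤-refl
  where
  go : ∀ k → k ≤ n → k ! ≤ n ^ k
  go zero _ = ≤-refl
  go (suc k) k<n = *-mono-≤ k<n (go k (<⇒≤ k<n))

^-monoˡ-∣ : ∀ {a b} e → a ∣ b → a ^ e ∣ b ^ e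
^-monoˡ-∣ zero a∣b = ∣-refl
^-monoˡ-∣ (suc e) a∣b = *-pres-∣ a∣b (^-monoˡ-∣ e a∣b)

^-monoʳ-∣ : ∀ a {e f} → e ≤ f → a ^ e ∣ a ^ f
^-monoʳ-∣ a {e} {f} e≤f = subst (a ^ e ∣_)
  (trans (sym (^-distribˡ-+-* a e (f ∸ e))) (cong (a ^_) (m+[n∸m]≡n e≤f))) (m∣m*n (a ^ (f ∸ e)))

^-cancelʳ-≤ : ∀ {e f} → 2 ^ e ≤ 2 ^ f → e ≤ f
^-cancelʳ-≤ {e} {f} le with e ≤? f
... | yes e≤f = e≤f
... | no e≰f = contradiction le (<⇒≱ (^-monoʳ-< 2 (s≤s (s≤s z≤n)) (≰⇒> e≰f)))

8k²<2^k : ∀ k → 10 ≤ k → 8 * (k * k) < 2 ^ k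
8k²<2^k k 10≤k = subst (λ k → 8 * (k * k) < 2 ^ k) (m+[n∸m]≡n 10≤k) (go (k ∸ 10))
  where
  go : ∀ i → 8 * ((10 + i) * (10 + i)) < 2 ^ (10 + i)
  -- The threshold is sharp: 648 > 512 at 9.
  go zero = <ᵇ⇒< 800 1024 _
  go (suc i) = begin-strict
    8 * ((11 + i) * (11 + i))     ≤⟨ m≤m+n _ (8 * (79 + 18 * i + i * i)) ⟩
    8 * ((11 + i) * (11 + i)) + 8 * (79 + 18 * i + i * i) ≡⟨ lem i ⟩
    2 * (8 * ((10 + i) * (10 + i))) <⟨ *-monoʳ-< 2 (go i) ⟩
    2 ^ (11 + i) ∎
    where
    open ≤-Reasoning
    lem : ∀ i → 8 * ((11 + i) * (11 + i)) + 8 * (79 + 18 * i + i * i) ≡ 2 * (8 * ((10 + i) * (10 + i)))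
    lem = solve-∀

-- If there were no such prime, every i ≤ N = 4^k would divide U: for q ≤ 2^k the power q^e divides the factorial part,
-- otherwise e ≤ 1. Then C(N,N/2) ∣ U by the harmonic triangle, but U < 2^(N/2).
noPrime⇒⊥ : ∀ k j → 10 ≤ k → k + k ≡ 3 + j →
            ¬ (∃[ p ] Prime p × 2 ^ j < p × p ≤ 2 ^ (k + k)) → ⊥
noPrime⇒⊥ k j 10≤k k+k≡3+j noPrime =
  <⇒≱ (^-monoʳ-< 2 (s≤s (s≤s z≤n)) smaller) (≤-trans 2^h≤U U≤)
  where
  U : ℕ
  U = ((2 ^ k) !) ^ (k + k) * centralProduct j

  instance
    U≢0 : NonZero U
    U≢0 = m*n≢0 _ _ {{m^n≢0 ((2 ^ k) !) (k + k) {{(2 ^ k) !≢0}}}} {{centralProduct-nonZero j}}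

  primePower∣U : ∀ q e → Prime q → q ^ e ≤ 2 ^ (k + k) → q ^ e ∣ U
  primePower∣U q e pq q^e≤N with q ≤? 2 ^ k
  ... | yes q≤s = ∣m⇒∣m*n _ (∣-trans (^-monoˡ-∣ e (m∣n! q≤s)) (^-monoʳ-∣ ((2 ^ k) !) e≤2k))
    where
    instance _ = prime⇒nonZero pq
    e≤2k : e ≤ k + k
    e≤2k = ^-cancelʳ-≤ (≤-trans (^-monoˡ-≤ e (nonTrivial⇒n>1 q {{prime⇒nonTrivial pq}})) q^e≤N)
  primePower∣U q zero pq q^e≤N | no q≰s = 1∣ U
  primePower∣U q (suc zero) pq q≤N | no q≰s =
    ∣n⇒∣m*n (((2 ^ k) !) ^ (k + k))
      (subst (_∣ centralProduct j) (sym (*-identityʳ q)) (prime∣centralProduct j pq q≤2^j))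
    where
    q≤2^j : q ≤ 2 ^ j
    q≤2^j with q ≤? 2 ^ j
    ... | yes q≤ = q≤
    ... | no q≰ = contradiction (q , pq , ≰⇒> q≰ , subst (_≤ 2 ^ (k + k)) (*-identityʳ q) q≤N) noPrime
  primePower∣U q (suc (suc e)) pq q^e≤N | no q≰s = contradiction q^e≤N (<⇒≱ (begin-strict
    2 ^ (k + k)      ≡⟨ ^-distribˡ-+-* 2 k k ⟩
    2 ^ k * 2 ^ k    <⟨ *-mono-< (≰⇒> q≰s) (≰⇒> q≰s) ⟩
    q * q            ≡⟨ *-identityʳ (q * q) ⟨
    q * q * 1        ≤⟨ *-monoʳ-≤ (q * q) (m^n>0 q e) ⟩
    q * q * q ^ e    ≡⟨ *-assoc q q (q ^ e) ⟩
    q ^ (2 + e)      ∎))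
    where
    open ≤-Reasoning
    instance _ = prime⇒nonZero pq

  all∣U : ∀ i → 1 ≤ i → i ≤ 2 ^ (k + k) → i ∣ U
  all∣U i 1≤i i≤N = primePowers∣⇒∣ U λ q e pq q^e∣i → primePower∣U q e pq (≤-trans (∣⇒≤ q^e∣i) i≤N)
    where instance _ = >-nonZero 1≤i

  h : ℕ
  h = 2 ^ (2 + j)

  N≡h+h : 2 ^ (k + k) ≡ h + h
  N≡h+h = trans (cong (2 ^_) k+k≡3+j) (2^1+j≡ (2 + j))

  2^h≤U : 2 ^ h ≤ U
  2^h≤U = begin
    2 ^ h               ≤⟨ 2^i≤[h+i]Ci h h ≤-refl ⟩
    (h + h) C h           ≤⟨ m≤n*m ((h + h) C h) h {{m^n≢0 2 (2 + j)}} ⟩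
    h * ((h + h) C h)     ≤⟨ ∣⇒≤ (hC∣U h refl) ⟩
    U                   ∎
    where
    open ≤-Reasoning
    hC∣U : ∀ i → i ≡ h → i * ((h + h) C i) ∣ U
    hC∣U zero    i≡ = contradiction (sym i≡) (≢-nonZero⁻¹ h {{m^n≢0 2 (2 + j)}})
    hC∣U (suc i) i≡ = [k+1]*nC[k+1]∣L (h + h) (λ m 1≤m m≤ → all∣U m 1≤m (subst (m ≤_) (sym N≡h+h) m≤)) i
      (subst (_≤ h + h) (sym i≡) (m≤m+n h h))

  U≤ : U ≤ 2 ^ (k * (2 ^ k * (k + k)) + 2 ^ suc j)
  U≤ = begin
    ((2 ^ k) !) ^ (k + k) * centralProduct j
      ≤⟨ *-mono-≤ (^-monoˡ-≤ (k + k) (n!≤n^n (2 ^ k))) (centralProduct-≤ j) ⟩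
    ((2 ^ k) ^ (2 ^ k)) ^ (k + k) * 2 ^ 2 ^ suc j
      ≡⟨ cong (_* 2 ^ 2 ^ suc j) (trans (^-*-assoc (2 ^ k) (2 ^ k) (k + k)) (^-*-assoc 2 k (2 ^ k * (k + k)))) ⟩
    2 ^ (k * (2 ^ k * (k + k))) * 2 ^ 2 ^ suc j   ≡⟨ ^-distribˡ-+-* 2 (k * (2 ^ k * (k + k))) (2 ^ suc j) ⟨
    2 ^ (k * (2 ^ k * (k + k)) + 2 ^ suc j)       ∎
    where open ≤-Reasoning

  -- The exponents 2 k² 2^k and N/4 of the two parts of `U` must add up to less than N/2; with N =
  -- 4^k this is 8 k² < 2^k.
  smaller : k * (2 ^ k * (k + k)) + 2 ^ suc j < h
  smaller = *-cancelˡ-< 4 _ _ (begin-strict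
    4 * (k * (2 ^ k * (k + k)) + 2 ^ suc j)     ≡⟨ lem k (2 ^ k) (2 ^ j) ⟩
    8 * (k * k) * 2 ^ k + 2 ^ (3 + j)           <⟨ +-monoˡ-< (2 ^ (3 + j))
      (*-monoˡ-< (2 ^ k) {{m^n≢0 2 k}} (8k²<2^k k 10≤k)) ⟩
    2 ^ k * 2 ^ k + 2 ^ (3 + j)
      ≡⟨ cong (_+ 2 ^ (3 + j)) (trans (sym (^-distribˡ-+-* 2 k k)) (cong (2 ^_) k+k≡3+j)) ⟩
    2 ^ (3 + j) + 2 ^ (3 + j)                   ≡⟨ lem₂ (2 ^ (2 + j)) ⟩
    4 * h                                       ∎)
    where
    open ≤-Reasoning
    lem : ∀ k s m → 4 * (k * (s * (k + k)) + 2 * m) ≡ 8 * (k * k) * s + 2 * (2 * (2 * m))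
    lem = solve-∀
    lem₂ : ∀ h → 2 * h + 2 * h ≡ 4 * h
    lem₂ = solve-∀

primeBetween : ∀ k → 10 ≤ k → ∃[ p ] Prime p × 4 ^ k < 8 * p × p ≤ 4 ^ k
primeBetween k 10≤k with anyUpTo? (λ p → prime? p ×-dec 2 ^ j <? p) (suc (2 ^ (k + k)))
  where j = k + k ∸ 3
... | yes (p , s≤s p≤N , pp , 2^j<p) = p , pp , (begin-strict
    4 ^ k               ≡⟨ 4^k≡ ⟩
    2 ^ (k + k)         ≡⟨ cong (2 ^_) k+k≡ ⟩
    2 ^ (3 + (k + k ∸ 3)) ≡⟨ lem (2 ^ (k + k ∸ 3)) ⟩
    8 * 2 ^ (k + k ∸ 3) <⟨ *-monoʳ-< 8 2^j<p ⟩
    8 * p               ∎) , subst (p ≤_) (sym 4^k≡) p≤N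
  where
  open ≤-Reasoning
  4^k≡ : 4 ^ k ≡ 2 ^ (k + k)
  4^k≡ = trans (^-*-assoc 2 2 k) (cong (2 ^_) (cong (k +_) (+-identityʳ k)))
  k+k≡ : k + k ≡ 3 + (k + k ∸ 3)
  k+k≡ = sym (m+[n∸m]≡n (≤-trans (≤-trans (<ᵇ⇒< 2 10 _) 10≤k) (m≤m+n k k)))
  lem : ∀ x → 2 * (2 * (2 * x)) ≡ 8 * x
  lem = solve-∀
... | no none = ⊥-elim (noPrime⇒⊥ k _ 10≤k
    (sym (m+[n∸m]≡n (≤-trans (≤-trans (<ᵇ⇒< 2 10 _) 10≤k) (m≤m+n k k))))
    λ { (p , pp , lt , le) → none (p , s≤s le , pp , lt) })

-- Upper bounds

sumI : (Index ns → ℕ) → ℕ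
sumI {ns = []}     f = f []
sumI {ns = n ∷ ns} f = sum {n} λ i → sumI λ is → f (i ∷ is)

sumI-cong : {f g : Index ns → ℕ} → (∀ x → f x ≡ g x) → sumI f ≡ sumI g
sumI-cong {ns = []}     f≡g = f≡g []
sumI-cong {ns = n ∷ ns} f≡g = sum-cong-≗ {n} λ i → sumI-cong λ is → f≡g (i ∷ is)

sumI-mono : {f g : Index ns → ℕ} → (∀ x → f x ≤ g x) → sumI f ≤ sumI g
sumI-mono {ns = []}     f≤g = f≤g []
sumI-mono {ns = n ∷ ns} f≤g = sum-mono {n} λ i → sumI-mono λ is → f≤g (i ∷ is)

sumI-+ : (f g : Index ns → ℕ) → sumI (λ x → f x + g x) ≡ sumI f + sumI g
sumI-+ {ns = []}     f g = refl
sumI-+ {ns = n ∷ ns} f g = trans (sum-cong-≗ {n} λ i → sumI-+ (λ is → f (i ∷ is)) (λ is → g (i ∷ is)))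
                                 (∑-distrib-+ {n} _ _)

sumI-* : ∀ c (f : Index ns → ℕ) → sumI (λ x → c * f x) ≡ c * sumI f
sumI-* {ns = []}     c f = refl
sumI-* {ns = n ∷ ns} c f = trans (sum-cong-≗ {n} λ i → sumI-* c (λ is → f (i ∷ is)))
                                 (sym (*-distribˡ-sum {n} c _))

sumI-const : ∀ c → sumI {ns = ns} (λ _ → c) ≡ c * sumI {ns = ns} (λ _ → 1)
sumI-const {ns = ns} c = trans (sumI-cong {ns = ns} λ _ → sym (*-identityʳ c)) (sumI-* {ns = ns} c λ _ → 1)

sum-const : ∀ n c → sum {n} (λ _ → c) ≡ n * c
sum-const zero    c = refl
sum-const (suc n) c = cong (c +_) (sum-const n c)

sumI-replicate-const : ∀ d n c → sumI {ns = replicate d n} (λ _ → c) ≡ n ^ d * c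
sumI-replicate-const zero    n c = sym (*-identityˡ c)
sumI-replicate-const (suc d) n c = begin
  sum {n} (λ _ → sumI {ns = replicate d n} λ _ → c)   ≡⟨ sum-cong-≗ {n} (λ _ → sumI-replicate-const d n c) ⟩
  sum {n} (λ _ → n ^ d * c)                           ≡⟨ sum-const n (n ^ d * c) ⟩
  n * (n ^ d * c)                                     ≡⟨ *-assoc n (n ^ d) c ⟨
  n * n ^ d * c                                       ∎
  where open ≡-Reasoning

ones≡sumI : (A : Matrix ns) → ones A ≡ sumI (⟦_⟧ ∘ A)
ones≡sumI {ns = []}     A = refl
ones≡sumI {ns = n ∷ ns} A = sum-cong-≗ {n} λ i → ones≡sumI λ is → A (i ∷ is)

-- (b - a)(d - c) ≥ 0, expanded.
rearrangement : ∀ {a b c d} → a ≤ b → c ≤ d → a * d + b * c ≤ a * c + b * d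
rearrangement {a} {_} {c} a≤b c≤d
  with b′ , refl ← m≤n⇒∃[o]m+o≡n a≤b | d′ , refl ← m≤n⇒∃[o]m+o≡n c≤d =
  subst (a * (c + d′) + (a + b′) * c ≤_) (sym (lem a b′ c d′)) (m≤m+n _ (b′ * d′))
  where
  lem : ∀ a b′ c d′ → a * c + (a + b′) * (c + d′) ≡ a * (c + d′) + (a + b′) * c + b′ * d′
  lem = solve-∀

chebyshev-pair : ∀ s a b → a * b ^ s + b * a ^ s ≤ a * a ^ s + b * b ^ s
chebyshev-pair s a b with ≤-total a b
... | inj₁ a≤b = rearrangement a≤b (^-monoˡ-≤ s a≤b)
... | inj₂ b≤a = subst₂ _≤_ (+-comm (b * a ^ s) (a * b ^ s)) (+-comm (b * b ^ s) (a * a ^ s))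
  (rearrangement b≤a (^-monoˡ-≤ s b≤a))

-- Chebyshev's sum inequality for the equally ordered v and v^s: sum `chebyshev-pair` over all pairs
-- (x, y), which doubles both sides.
chebyshev : ∀ s (v : Index ns → ℕ) →
  sumI v * sumI (λ x → v x ^ s) ≤ sumI {ns = ns} (λ _ → 1) * sumI (λ x → v x ^ suc s)
chebyshev {ns = ns} s v = *-cancelˡ-≤ 2 (begin
  2 * (V * W)
    ≡⟨ lem₁ V W ⟩
  W * V + V * W
    ≡⟨ cong₂ _+_ (sumI-* W v) (sumI-* V w) ⟨
  sumI (λ x → W * v x) + sumI (λ x → V * w x)
    ≡⟨ sumI-+ (λ x → W * v x) (λ x → V * w x) ⟨
  sumI (λ x → W * v x + V * w x)
    ≡⟨ sumI-cong (λ x → cong₂ _+_ (trans (*-comm W (v x)) (sym (sumI-* (v x) w)))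
                                  (trans (*-comm V (w x)) (sym (sumI-* (w x) v)))) ⟩
  sumI (λ x → sumI (λ y → v x * w y) + sumI (λ y → w x * v y))
    ≡⟨ sumI-cong (λ x → sumI-+ (λ y → v x * w y) (λ y → w x * v y)) ⟨
  sumI (λ x → sumI λ y → v x * w y + w x * v y)
    ≤⟨ sumI-mono (λ x → sumI-mono λ y →
         subst (λ a → v x * w y + a ≤ u x + u y) (*-comm (v y) (w x)) (chebyshev-pair s (v x) (v y))) ⟩
  sumI (λ x → sumI λ y → u x + u y)
    ≡⟨ sumI-cong (λ x → trans (sumI-+ (λ _ → u x) u)
         (cong (_+ U) (trans (sumI-const {ns = ns} (u x)) (*-comm (u x) N)))) ⟩
  sumI (λ x → N * u x + U)
    ≡⟨ sumI-+ (λ x → N * u x) (λ _ → U) ⟩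
  sumI (λ x → N * u x) + sumI {ns = ns} (λ _ → U)
    ≡⟨ cong₂ _+_ (sumI-* N u) (sumI-const {ns = ns} U) ⟩
  N * U + U * N
    ≡⟨ lem₂ N U ⟩
  2 * (N * U) ∎)
  where
  open ≤-Reasoning
  w u : Index ns → ℕ
  w x = v x ^ s
  u x = v x ^ suc s
  V W U N : ℕ
  V = sumI v
  W = sumI w
  U = sumI u
  N = sumI {ns = ns} λ _ → 1
  lem₁ : ∀ a b → 2 * (a * b) ≡ b * a + a * b
  lem₁ = solve-∀
  lem₂ : ∀ a b → a * b + b * a ≡ 2 * (a * b)
  lem₂ = solve-∀

-- By `chebyshev`, each further power trades a factor Σ v for the number of indices.
powerMean : ∀ s (v : Index ns → ℕ) →
  sumI v ^ suc s ≤ sumI {ns = ns} (λ _ → 1) ^ s * sumI (λ x → v x ^ suc s)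
powerMean zero v = ≤-reflexive (begin
  sumI v * 1                  ≡⟨ *-identityʳ _ ⟩
  sumI v                      ≡⟨ sumI-cong (λ x → sym (*-identityʳ (v x))) ⟩
  sumI (λ x → v x ^ 1)        ≡⟨ *-identityˡ _ ⟨
  1 * sumI (λ x → v x ^ 1)    ∎)
  where open ≡-Reasoning
powerMean {ns = ns} (suc s) v = begin
  V * V ^ suc s             ≤⟨ *-monoʳ-≤ V (powerMean s v) ⟩
  V * (N ^ s * W)           ≡⟨ lem V (N ^ s) W ⟩
  N ^ s * (V * W)           ≤⟨ *-monoʳ-≤ (N ^ s) (chebyshev (suc s) v) ⟩
  N ^ s * (N * U)           ≡⟨ lem₂ (N ^ s) N U ⟩
  N * N ^ s * U             ∎
  where
  open ≤-Reasoning
  V N W U : ℕ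
  V = sumI v
  N = sumI {ns = ns} λ _ → 1
  W = sumI λ x → v x ^ suc s
  U = sumI λ x → v x ^ suc (suc s)
  lem : ∀ a b c → a * (b * c) ≡ b * (a * c)
  lem = solve-∀
  lem₂ : ∀ a b c → a * (b * c) ≡ b * a * c
  lem₂ = solve-∀

sumC : (Choice k n → ℕ) → ℕ
sumC {zero}  {zero}  f = f done
sumC {suc k} {zero}  f = 0
sumC {zero}  {suc n} f = sumC (f ∘ drop)
sumC {suc k} {suc n} f = sumC (f ∘ drop) + sumC (f ∘ keep)

sumC-0 : ∀ k n → sumC {k} {n} (λ _ → 0) ≡ 0
sumC-0 zero    zero    = refl
sumC-0 (suc k) zero    = refl
sumC-0 zero    (suc n) = sumC-0 zero n
sumC-0 (suc k) (suc n) = cong₂ _+_ (sumC-0 (suc k) n) (sumC-0 k n)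

-- The C(n,k) choices are bounded by n^k; only the order of magnitude matters.
sumC-≤ : ∀ k n {f : Choice k n → ℕ} {B} → (∀ c → f c ≤ B) → sumC f ≤ n ^ k * B
sumC-≤ zero    zero    {B = B} f≤B = ≤-trans (f≤B done) (≤-reflexive (sym (*-identityˡ B)))
sumC-≤ (suc k) zero    f≤B = z≤n
sumC-≤ zero    (suc n) f≤B = sumC-≤ zero n (f≤B ∘ drop)
sumC-≤ (suc k) (suc n) {f} {B} f≤B = begin
  sumC (f ∘ drop) + sumC (f ∘ keep)   ≤⟨ +-mono-≤ (sumC-≤ (suc k) n (f≤B ∘ drop)) (sumC-≤ k n (f≤B ∘ keep)) ⟩
  n ^ suc k * B + n ^ k * B           ≡⟨ lem n (n ^ k) B ⟩
  suc n * n ^ k * B                   ≤⟨ *-monoˡ-≤ B (*-monoʳ-≤ (suc n) (^-monoˡ-≤ k (n≤1+n n))) ⟩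
  suc n ^ suc k * B                   ∎
  where
  open ≤-Reasoning
  lem : ∀ n m B → n * m * B + m * B ≡ suc n * m * B
  lem = solve-∀

sumI-sumC : ∀ k n (f : Index ns → Choice k n → ℕ) →
            sumI (λ x → sumC (f x)) ≡ sumC (λ c → sumI (λ x → f x c))
sumI-sumC zero    zero    f = refl
sumI-sumC {ns = ns} (suc k) zero f = sumI-const {ns = ns} 0
sumI-sumC zero    (suc n) f = sumI-sumC zero n (λ x → f x ∘ drop)
sumI-sumC (suc k) (suc n) f = trans (sumI-+ (λ x → sumC (f x ∘ drop)) (λ x → sumC (f x ∘ keep)))
  (cong₂ _+_ (sumI-sumC (suc k) n (λ x → f x ∘ drop)) (sumI-sumC k n (λ x → f x ∘ keep)))

hits : (Fin n → Bool) → Choice k n → Bool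
hits f done     = true
hits f (drop c) = hits (f ∘ suc) c
hits f (keep c) = f zero ∧ hits (f ∘ suc) c

hits≤ : (f : Fin n → Bool) (c : Choice k n) (j : Fin k) → hits f c Bool.≤ f (chosen c j)
hits≤ f (drop c) j = hits≤ (f ∘ suc) c j
hits≤ f (keep c) zero with f zero
... | false = Bool.b≤b
... | true  = Bool.≤-maximum _
hits≤ f (keep c) (suc j) with f zero
... | false = Bool.≤-minimum _
... | true  = hits≤ (f ∘ suc) c j

-- The choices hitting only ones are the `k`-subsets of the support of `f`.
sumC-hits : ∀ k n (f : Fin n → Bool) → sumC {k} {n} (⟦_⟧ ∘ hits f) ≡ sum (⟦_⟧ ∘ f) C k
sumC-hits zero    zero    f = refl
sumC-hits (suc k) zero    f = refl
sumC-hits zero    (suc n) f = sumC-hits zero n (f ∘ suc)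
sumC-hits (suc k) (suc n) f with f zero
... | false = trans (cong₂ _+_ (sumC-hits (suc k) n (f ∘ suc)) (sumC-0 k n)) (+-identityʳ _)
... | true  = begin
  sumC {suc k} {n} (⟦_⟧ ∘ hits (f ∘ suc)) + sumC {k} {n} (⟦_⟧ ∘ hits (f ∘ suc))
    ≡⟨ cong₂ _+_ (sumC-hits (suc k) n (f ∘ suc)) (sumC-hits k n (f ∘ suc)) ⟩
  r C suc k + r C k     ≡⟨ +-comm (r C suc k) (r C k) ⟩
  r C k + r C suc k     ≡⟨ nCk+nC[k+1]≡[n+1]C[k+1] r k ⟩
  suc r C suc k         ∎
  where
  open ≡-Reasoning
  r = sum (⟦_⟧ ∘ f ∘ suc)

[n∸k]*nCk≡[k+1]*nC[k+1] : ∀ n k → (n ∸ k) * (n C k) ≡ suc k * (n C suc k)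
[n∸k]*nCk≡[k+1]*nC[k+1] n k = begin
  (n ∸ k) * (n C k)                                     ≡⟨ *-distribʳ-∸ (n C k) (suc n) (suc k) ⟩
  suc n * (n C k) ∸ suc k * (n C k)
    ≡⟨ cong (_∸ suc k * (n C k)) ([k+1]*[n+1]C[k+1]≡[n+1]*nCk n k) ⟨
  suc k * (suc n C suc k) ∸ suc k * (n C k)
    ≡⟨ cong (λ m → suc k * m ∸ suc k * (n C k)) (nCk+nC[k+1]≡[n+1]C[k+1] n k) ⟨
  suc k * (n C k + n C suc k) ∸ suc k * (n C k)
    ≡⟨ cong (_∸ suc k * (n C k)) (*-distribˡ-+ (suc k) (n C k) (n C suc k)) ⟩
  suc k * (n C k) + suc k * (n C suc k) ∸ suc k * (n C k) ≡⟨ m+n∸m≡n (suc k * (n C k)) _ ⟩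
  suc k * (n C suc k)                                   ∎
  where open ≡-Reasoning

-- For n ≥ k the right side is a falling factorial whose `k` factors all exceed n - k; for n < k
-- truncation makes the left side 0. The power mean inequality needs a power in place of the
-- binomial coefficient.
[n∸k]^k≤k!*nCk : ∀ n k → (n ∸ k) ^ k ≤ k ! * (n C k)
[n∸k]^k≤k!*nCk n zero    = ≤-refl
[n∸k]^k≤k!*nCk n (suc k) = begin
  (n ∸ suc k) * (n ∸ suc k) ^ k   ≤⟨ *-mono-≤ n∸[1+k]≤n∸k (≤-trans (^-monoˡ-≤ k n∸[1+k]≤n∸k) ([n∸k]^k≤k!*nCk n k)) ⟩
  (n ∸ k) * (k ! * (n C k))       ≡⟨ lem (n ∸ k) (k !) (n C k) ⟩
  k ! * ((n ∸ k) * (n C k))       ≡⟨ cong (k ! *_) ([n∸k]*nCk≡[k+1]*nC[k+1] n k) ⟩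
  k ! * (suc k * (n C suc k))     ≡⟨ lem₂ (k !) (suc k) (n C suc k) ⟩
  suc k * k ! * (n C suc k)       ∎
  where
  open ≤-Reasoning
  n∸[1+k]≤n∸k : n ∸ suc k ≤ n ∸ k
  n∸[1+k]≤n∸k = ∸-monoʳ-≤ n (n≤1+n k)
  lem : ∀ a b c → a * (b * c) ≡ b * (a * c)
  lem = solve-∀
  lem₂ : ∀ a b c → a * (b * c) ≡ b * a * c
  lem₂ = solve-∀

-- `replicate (suc d) n` does not compute to `replicate d n ∷ʳ n`, so the last coordinate is
-- appended by recursion on `d`.
snocIndex : ∀ d → Index (replicate d n) → Fin n → Index (replicate (suc d) n)
snocIndex zero    []       j = j ∷ []
snocIndex (suc d) (i ∷ is) j = i ∷ snocIndex d is j

ones-snocIndex : ∀ d n (A : Matrix (replicate (suc d) n)) →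
  ones A ≡ sumI {ns = replicate d n} λ x → sum {n} λ j → ⟦ A (snocIndex d x j) ⟧
ones-snocIndex zero    n A = refl
ones-snocIndex (suc d) n A = sum-cong-≗ {n} λ i → ones-snocIndex d n λ is → A (i ∷ is)

lastIndex : (ns : Vec ℕ d) → Index (ns ∷ʳ k) → Fin k
lastIndex []       (j ∷ []) = j
lastIndex (n ∷ ns) (i ∷ is) = lastIndex ns is

snocChoices : {ns : Vec ℕ d} → Choices ns (replicate d n) → Choice k n →
              Choices (ns ∷ʳ k) (replicate (suc d) n)
snocChoices {ns = []}    []       c′ = c′ ∷ []
snocChoices {ns = _ ∷ _} (c ∷ cs) c′ = c ∷ snocChoices cs c′

chosenIndex-snocChoices : {ns : Vec ℕ d} (cs : Choices ns (replicate d n)) (c : Choice k n) (is : Index (ns ∷ʳ k)) →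
  chosenIndex (snocChoices cs c) is ≡ snocIndex d (chosenIndex cs (initIndex ns is)) (chosen c (lastIndex ns is))
chosenIndex-snocChoices {ns = []}    []       c (j ∷ []) = refl
chosenIndex-snocChoices {ns = _ ∷ _} (c′ ∷ cs) c (i ∷ is) = cong (chosen c′ i ∷_) (chosenIndex-snocChoices cs c is)

commonSlice : ∀ d → Matrix (replicate (suc d) n) → Choice k n → Matrix (replicate d n)
commonSlice d A c x = hits (A ∘ snocIndex d x) c

-- A copy of `P` in the intersection of the slices at the chosen heights, repeated at all of them,
-- is a copy of the stack in `A`.
commonSlice-avoids : {ns : Vec ℕ d} (P : Matrix ns) (A : Matrix (replicate (suc d) n)) →
  A Avoids stack P k → (c : Choice k n) → commonSlice d A c Avoids P
commonSlice-avoids {d} {ns = ns} P A avoids c (cs , P≤) = avoids (snocChoices cs c , λ is →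
  subst (λ x → P (initIndex ns is) Bool.≤ A x) (sym (chosenIndex-snocChoices cs c is))
    (Bool.≤-trans (P≤ (initIndex ns is))
      (hits≤ (A ∘ snocIndex d (chosenIndex cs (initIndex ns is))) c (lastIndex ns is))))

^-distribʳ-* : ∀ t m n → (m * n) ^ t ≡ m ^ t * n ^ t
^-distribʳ-* zero    m n = refl
^-distribʳ-* (suc t) m n = trans (cong (m * n *_) (^-distribʳ-* t m n)) (lem m n (m ^ t) (n ^ t))
  where
  lem : ∀ a b c d → a * b * (c * d) ≡ a * c * (b * d)
  lem = solve-∀

[m+n]^t≤ : ∀ m n t → (m + n) ^ t ≤ 2 ^ t * (m ^ t + n ^ t)
[m+n]^t≤ m n t = [ (λ m≤n → half m n m≤n) , (λ n≤m →
  subst₂ (λ a b → a ^ t ≤ 2 ^ t * b) (+-comm n m) (+-comm (n ^ t) (m ^ t)) (half n m n≤m)) ]′ (≤-total m n)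
  where
  open ≤-Reasoning
  half : ∀ m n → m ≤ n → (m + n) ^ t ≤ 2 ^ t * (m ^ t + n ^ t)
  half m n m≤n = begin
    (m + n) ^ t               ≤⟨ ^-monoˡ-≤ t (+-monoˡ-≤ n m≤n) ⟩
    (n + n) ^ t               ≡⟨ cong (_^ t) (cong (n +_) (sym (+-identityʳ n))) ⟩
    (2 * n) ^ t               ≡⟨ ^-distribʳ-* t 2 n ⟩
    2 ^ t * n ^ t             ≤⟨ *-monoʳ-≤ (2 ^ t) (m≤n+m (n ^ t) (m ^ t)) ⟩
    2 ^ t * (m ^ t + n ^ t)   ∎

-- 2^t comes from splitting the sum, t^t from the t ones set aside on each line, t! from comparing
-- (r - t)^t with C(r,t).
kst-constant : ℕ → ℕ
kst-constant t = 2 ^ t * (t ^ t + t !)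

-- Only r ∸ t of the r ones on a line enter the count, since t! C(r,t) bounds (r - t)^t but not r^t;
-- the t ones set aside per line give the term n^(dt).
kővári-sós-turán : ∀ {d} n s {ns : Vec ℕ d} (P : Matrix ns) (A : Matrix (replicate (suc d) n)) →
  A Avoids stack P (suc s) →
  ones A ^ suc s ≤ kst-constant (suc s) * (n ^ (d * suc s) + n ^ (d * s + suc s) * ex n P)
kővári-sós-turán {d} n s P A avoids = begin
  ones A ^ t                                  ≤⟨ ^-monoˡ-≤ t ones≤ ⟩
  (n ^ d * t + V) ^ t                         ≤⟨ [m+n]^t≤ (n ^ d * t) V t ⟩
  2 ^ t * ((n ^ d * t) ^ t + V ^ t)           ≤⟨ *-monoʳ-≤ (2 ^ t) (+-mono-≤ (≤-reflexive first) second) ⟩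
  -- The mixed terms are added to factor out a single constant.
  2 ^ t * (t ^ t * X + t ! * Y)               ≤⟨ *-monoʳ-≤ (2 ^ t) (m≤m+n _ (t ^ t * Y + t ! * X)) ⟩
  2 ^ t * (t ^ t * X + t ! * Y + (t ^ t * Y + t ! * X)) ≡⟨ lem (2 ^ t) (t ^ t) (t !) X Y ⟩
  2 ^ t * (t ^ t + t !) * (X + Y)             ∎
  where
  open ≤-Reasoning
  t X Y V : ℕ
  t = suc s
  X = n ^ (d * t)
  Y = n ^ (d * s + t) * ex n P
  r : Index (replicate d n) → ℕ
  r x = sum {n} λ j → ⟦ A (snocIndex d x j) ⟧
  V = sumI {ns = replicate d n} λ x → r x ∸ t
  lem : ∀ a b c X Y → a * (b * X + c * Y + (b * Y + c * X)) ≡ a * (b + c) * (X + Y)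
  lem = solve-∀
  ones≤ : ones A ≤ n ^ d * t + V
  ones≤ = begin
    ones A                                                ≡⟨ ones-snocIndex d n A ⟩
    sumI {ns = replicate d n} r                           ≤⟨ sumI-mono {ns = replicate d n} (λ x → m≤n+m∸n (r x) t) ⟩
    sumI {ns = replicate d n} (λ x → t + (r x ∸ t))       ≡⟨ sumI-+ {ns = replicate d n} (λ _ → t) (λ x → r x ∸ t) ⟩
    sumI {ns = replicate d n} (λ _ → t) + V               ≡⟨ cong (_+ V) (sumI-replicate-const d n t) ⟩
    n ^ d * t + V                                         ∎
  first : (n ^ d * t) ^ t ≡ t ^ t * X
  first = trans (^-distribʳ-* t (n ^ d) t) (trans (cong (_* t ^ t) (^-*-assoc n d t)) (*-comm X (t ^ t)))
  doubleCount : sumI {ns = replicate d n} (λ x → r x C t) ≤ n ^ t * ex n P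
  doubleCount = begin
    sumI {ns = replicate d n} (λ x → r x C t)
      ≡⟨ sumI-cong {ns = replicate d n} (λ x → sumC-hits t n (A ∘ snocIndex d x)) ⟨
    sumI {ns = replicate d n} (λ x → sumC {t} {n} λ c → ⟦ commonSlice d A c x ⟧)
      ≡⟨ sumI-sumC {ns = replicate d n} t n (λ x c → ⟦ commonSlice d A c x ⟧) ⟩
    sumC {t} {n} (λ c → sumI {ns = replicate d n} λ x → ⟦ commonSlice d A c x ⟧)
      ≤⟨ sumC-≤ t n (λ c → subst (_≤ ex n P) (ones≡sumI (commonSlice d A c))
           (ex-upper P (commonSlice d A c) (commonSlice-avoids P A avoids c))) ⟩
    n ^ t * ex n P ∎
  second : V ^ t ≤ t ! * Y
  second = begin
    V ^ t
      ≤⟨ powerMean s (λ x → r x ∸ t) ⟩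
    sumI {ns = replicate d n} (λ _ → 1) ^ s * sumI {ns = replicate d n} (λ x → (r x ∸ t) ^ t)
      ≤⟨ *-monoʳ-≤ (sumI {ns = replicate d n} (λ _ → 1) ^ s) (sumI-mono {ns = replicate d n} λ x →
        [n∸k]^k≤k!*nCk (r x) t) ⟩
    sumI {ns = replicate d n} (λ _ → 1) ^ s * sumI {ns = replicate d n} (λ x → t ! * (r x C t))
      ≡⟨ cong₂ (λ a b → a ^ s * b) (trans (sumI-replicate-const d n 1) (*-identityʳ (n ^ d)))
        (sumI-* {ns = replicate d n} (t !) (λ x → r x C t)) ⟩
    (n ^ d) ^ s * (t ! * sumI {ns = replicate d n} (λ x → r x C t))
      ≤⟨ *-monoʳ-≤ ((n ^ d) ^ s) (*-monoʳ-≤ (t !) doubleCount) ⟩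
    (n ^ d) ^ s * (t ! * (n ^ t * ex n P))
      ≡⟨ cong (_* (t ! * (n ^ t * ex n P))) (^-*-assoc n d s) ⟩
    n ^ (d * s) * (t ! * (n ^ t * ex n P))
      ≡⟨ lem₂ (n ^ (d * s)) (t !) (n ^ t) (ex n P) ⟩
    t ! * (n ^ (d * s) * n ^ t * ex n P)
      ≡⟨ cong (λ m → t ! * (m * ex n P)) (^-distribˡ-+-* n (d * s) t) ⟨
    t ! * Y ∎
    where
    lem₂ : ∀ a b c d → a * (b * (c * d)) ≡ b * (a * c * d)
    lem₂ = solve-∀

-- `ex` is a maximum with default 0, so the property has to hold at 0 as well; this covers a `Q`
-- that no matrix avoids.
ex-elim : ∀ n {ms : Vec ℕ d} (Q : Matrix ms) (R : ℕ → Set) → R 0 →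
  (∀ A → _Avoids_ {ns = replicate d n} A Q → R (ones A)) → R (ex n Q)
ex-elim {d} n Q R r₀ r =
  [ (λ ex≡0 → subst R (sym ex≡0) r₀)
  , (λ ex∈ → attained (∈-map⁻ ones ex∈)) ]′
  (Extrema.argmax-sel (λ v → v) 0 _)
  where
  attained : ∃[ A ] _ × ex n Q ≡ ones A → R (ex n Q)
  attained (A , A∈ , ex≡) = subst R (sym ex≡)
    (r A (proj₂ (∈-filter⁻ (λ M → ¬? (contains? M Q)) {xs = matrices (replicate d n)} A∈)))

-- Lower bounds

-- Valued in ℕ, so that coordinates along axes of different lengths have one type and can index `M`.
coordinate : Index {d} ns → Fin d → ℕ
coordinate (i ∷ is) zero    = toℕ i
coordinate (i ∷ is) (suc κ) = coordinate is κ

chosen-injective : (c : Choice k n) {i j : Fin k} → chosen c i ≡ chosen c j → i ≡ j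
chosen-injective (drop c) eq = chosen-injective c (Fin.suc-injective eq)
chosen-injective (keep c) {zero}  {zero}  eq = refl
chosen-injective (keep c) {suc i} {suc j} eq = cong suc (chosen-injective c (Fin.suc-injective eq))

-- Passing to a submatrix acts on each coordinate separately by an injection, so equality of
-- coordinates is reflected and, by the next lemma, preserved.
coordinate-chosenIndex-injective : (cs : Choices {d} ms ns) (κ : Fin d) (is js : Index ms) →
  coordinate (chosenIndex cs is) κ ≡ coordinate (chosenIndex cs js) κ → coordinate is κ ≡ coordinate js κ
coordinate-chosenIndex-injective (c ∷ cs) zero    (i ∷ is) (j ∷ js) eq =
  cong toℕ (chosen-injective c (toℕ-injective eq))
coordinate-chosenIndex-injective (c ∷ cs) (suc κ) (i ∷ is) (j ∷ js) eq =
  coordinate-chosenIndex-injective cs κ is js eq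

coordinate-chosenIndex-cong : (cs : Choices {d} ms ns) (κ : Fin d) (is js : Index ms) →
  coordinate is κ ≡ coordinate js κ → coordinate (chosenIndex cs is) κ ≡ coordinate (chosenIndex cs js) κ
coordinate-chosenIndex-cong (c ∷ cs) zero    (i ∷ is) (j ∷ js) eq = cong (toℕ ∘ chosen c) (toℕ-injective eq)
coordinate-chosenIndex-cong (c ∷ cs) (suc κ) (i ∷ is) (j ∷ js) eq = coordinate-chosenIndex-cong cs κ is js eq

true≤⇒≡true : ∀ {a b} → a ≡ true → a Bool.≤ b → b ≡ true
true≤⇒≡true refl Bool.b≤b = refl

sum-≡-const : ∀ n {f : Fin n → ℕ} {c} → (∀ i → f i ≡ c) → sum f ≡ n * c
sum-≡-const n {c = c} f≡c = trans (sum-cong-≗ {n} f≡c) (sum-const n c)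

ones-const : ∀ d n b → ones {ns = replicate d n} (λ _ → b) ≡ n ^ d * ⟦ b ⟧
ones-const zero    n b = sym (*-identityˡ ⟦ b ⟧)
ones-const (suc d) n b = trans (sum-≡-const n λ _ → ones-const d n b) (sym (*-assoc n (n ^ d) ⟦ b ⟧))

ones-coordinate : ∀ d n (κ : Fin (suc d)) (g : ℕ → Bool) →
  ones {ns = replicate (suc d) n} (λ x → g (coordinate x κ)) ≡ n ^ d * Σ< n (⟦_⟧ ∘ g)
ones-coordinate d       n zero    g = trans (sum-cong-≗ {n} λ i → ones-const d n (g (toℕ i)))
                                            (sym (*-distribˡ-sum {n} (n ^ d) λ i → ⟦ g (toℕ i) ⟧))
ones-coordinate (suc d) n (suc κ) g = trans (sum-≡-const n λ _ → ones-coordinate d n κ g) (sym (*-assoc n (n ^ d) _))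

ones-coordinate₂ : ∀ d n (κ : Fin (suc d)) (M : ℕ → ℕ → Bool) →
  ones {ns = replicate (suc (suc d)) n} (λ x → M (coordinate x (inject₁ κ)) (coordinate x (fromℕ (suc d)))) ≡
  n ^ d * (Σ< n λ i → Σ< n λ j → ⟦ M i j ⟧)
ones-coordinate₂ d       n zero    M = trans (sum-cong-≗ {n} λ i → ones-coordinate d n (fromℕ d) (M (toℕ i)))
                                             (sym (*-distribˡ-sum {n} (n ^ d) λ i → Σ< n λ j → ⟦ M (toℕ i) j ⟧))
ones-coordinate₂ (suc d) n (suc κ) M =
  trans (sum-≡-const n λ _ → ones-coordinate₂ d n κ M) (sym (*-assoc n (n ^ d) _))

-- The hyperplane where the κ-th coordinate is 0, filled with ones, avoids `P`: all ones of a copy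
-- would share that coordinate.
n^d≤ex : ∀ {d} {ns : Vec ℕ (suc d)} (P : Matrix ns) n → 1 ≤ n → (κ : Fin (suc d)) (x y : Index ns) →
  P x ≡ true → P y ≡ true → coordinate x κ ≢ coordinate y κ → n ^ d ≤ ex n P
n^d≤ex {d} P n 1≤n κ x y Px Py x≢y = begin
  n ^ d                             ≡⟨ *-identityʳ (n ^ d) ⟨
  n ^ d * 1                         ≤⟨ *-monoʳ-≤ (n ^ d) (single-≤-Σ< {f = ⟦_⟧ ∘ (_≡ᵇ 0)} 0 1≤n ≤-refl) ⟩
  n ^ d * Σ< n (⟦_⟧ ∘ (_≡ᵇ 0))      ≡⟨ ones-coordinate d n κ (_≡ᵇ 0) ⟨
  ones A                            ≤⟨ ex-upper P A avoids ⟩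
  ex n P                            ∎
  where
  open ≤-Reasoning
  A : Matrix (replicate (suc d) n)
  A z = coordinate z κ ≡ᵇ 0
  ≡ᵇ-true⇒≡ : ∀ m → (m ≡ᵇ 0) ≡ true → m ≡ 0
  ≡ᵇ-true⇒≡ zero _ = refl
  avoids : A Avoids P
  avoids (cs , P≤) = x≢y (coordinate-chosenIndex-injective cs κ x y (trans (zeroAt x Px) (sym (zeroAt y Py))))
    where
    zeroAt : ∀ z → P z ≡ true → coordinate (chosenIndex cs z) κ ≡ 0
    zeroAt z Pz = ≡ᵇ-true⇒≡ _ (true≤⇒≡true Pz (P≤ z))

_∷ʳᴵ_ : {ns : Vec ℕ d} → Index ns → Fin k → Index (ns ∷ʳ k)
[]       ∷ʳᴵ j = j ∷ []
(i ∷ is) ∷ʳᴵ j = i ∷ (is ∷ʳᴵ j)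

initIndex-∷ʳᴵ : {ns : Vec ℕ d} (x : Index ns) (j : Fin k) → initIndex ns (x ∷ʳᴵ j) ≡ x
initIndex-∷ʳᴵ []       j = refl
initIndex-∷ʳᴵ (i ∷ is) j = cong (i ∷_) (initIndex-∷ʳᴵ is j)

coordinate-∷ʳᴵ-init : {ns : Vec ℕ d} (x : Index ns) (j : Fin k) (κ : Fin d) →
  coordinate (x ∷ʳᴵ j) (inject₁ κ) ≡ coordinate x κ
coordinate-∷ʳᴵ-init (i ∷ is) j zero    = refl
coordinate-∷ʳᴵ-init (i ∷ is) j (suc κ) = coordinate-∷ʳᴵ-init is j κ

coordinate-∷ʳᴵ-last : {ns : Vec ℕ d} (x : Index ns) (j : Fin k) → coordinate (x ∷ʳᴵ j) (fromℕ d) ≡ toℕ j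
coordinate-∷ʳᴵ-last []       j = refl
coordinate-∷ʳᴵ-last (i ∷ is) j = coordinate-∷ʳᴵ-last is j

cylinder-≤-ex : ∀ {d s} {ns : Vec ℕ (suc d)} (P : Matrix ns) n (κ : Fin (suc d)) (xs : Fin (suc s) → Index ns) →
  (∀ i → P (xs i) ≡ true) → (∀ {i j} → coordinate (xs i) κ ≡ coordinate (xs j) κ → i ≡ j) →
  (M : ℕ → ℕ → Bool) → KFree (suc s) M →
  n ^ d * (Σ< n λ i → Σ< n λ j → ⟦ M i j ⟧) ≤ ex n (stack P (suc s))
cylinder-≤-ex {d} {s} {ns} P n κ xs Pxs xs-inj M M-free = begin
  n ^ d * (Σ< n λ i → Σ< n λ j → ⟦ M i j ⟧)   ≡⟨ ones-coordinate₂ d n κ M ⟨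
  ones A                                      ≤⟨ ex-upper (stack P (suc s)) A avoids ⟩
  ex n (stack P (suc s))                      ∎
  where
  open ≤-Reasoning
  A : Matrix (replicate (suc (suc d)) n)
  A z = M (coordinate z (inject₁ κ)) (coordinate z (fromℕ (suc d)))
  avoids : A Avoids stack P (suc s)
  avoids (cs , P≤) = M-free rows columns rows-inj columns-inj λ i j →
    subst₂ (λ r c → M r c ≡ true)
      (coordinate-chosenIndex-cong cs (inject₁ κ) (xs i ∷ʳᴵ j) (xs i ∷ʳᴵ zero)
        (trans (coordinate-∷ʳᴵ-init (xs i) j κ) (sym (coordinate-∷ʳᴵ-init (xs i) zero κ))))
      (coordinate-chosenIndex-cong cs (fromℕ (suc d)) (xs i ∷ʳᴵ j) (xs zero ∷ʳᴵ j)
        (trans (coordinate-∷ʳᴵ-last (xs i) j) (sym (coordinate-∷ʳᴵ-last (xs zero) j))))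
      (true≤⇒≡true (trans (cong P (initIndex-∷ʳᴵ (xs i) j)) (Pxs i)) (P≤ (xs i ∷ʳᴵ j)))
    where
    -- In a copy the row depends only on i and the column only on j, so each is read off at a fixed
    -- value of the other.
    rows columns : Fin (suc s) → ℕ
    rows    i = coordinate (chosenIndex cs (xs i ∷ʳᴵ zero)) (inject₁ κ)
    columns j = coordinate (chosenIndex cs (xs zero ∷ʳᴵ j)) (fromℕ (suc d))
    rows-inj : ∀ {i j} → rows i ≡ rows j → i ≡ j
    rows-inj {i} {j} eq = xs-inj (trans (sym (coordinate-∷ʳᴵ-init (xs i) zero κ))
      (trans (coordinate-chosenIndex-injective cs (inject₁ κ) (xs i ∷ʳᴵ zero) (xs j ∷ʳᴵ zero) eq)
             (coordinate-∷ʳᴵ-init (xs j) zero κ)))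
    columns-inj : ∀ {i j} → columns i ≡ columns j → i ≡ j
    columns-inj {i} {j} eq = toℕ-injective (trans (sym (coordinate-∷ʳᴵ-last (xs zero) i))
      (trans (coordinate-chosenIndex-injective cs (fromℕ (suc d)) (xs zero ∷ʳᴵ i) (xs zero ∷ʳᴵ j) eq)
             (coordinate-∷ʳᴵ-last (xs zero) j)))

1≤sum⇒ : {f : Fin n → ℕ} → 1 ≤ sum f → ∃[ i ] 1 ≤ f i
1≤sum⇒ {suc n} {f} 1≤ with f zero in eq
... | suc _ = zero , subst (1 ≤_) (sym eq) (s≤s z≤n)
... | zero  with i , 1≤fi ← 1≤sum⇒ {n} 1≤ = suc i , 1≤fi

2≤sum⇒ : {f : Fin n → ℕ} → 2 ≤ sum f → (∃[ i ] 2 ≤ f i) ⊎ (∃[ i ] ∃[ j ] i ≢ j × 1 ≤ f i × 1 ≤ f j)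
2≤sum⇒ {suc n} {f} 2≤ with f zero in eq
... | suc (suc _) = inj₁ (zero , subst (2 ≤_) (sym eq) (s≤s (s≤s z≤n)))
... | suc zero with i , 1≤fi ← 1≤sum⇒ {n} (s≤s⁻¹ 2≤) =
  inj₂ (zero , suc i , (λ ()) , subst (1 ≤_) (sym eq) (s≤s z≤n) , 1≤fi)
2≤sum⇒ {suc n} {f} 2≤ | zero with 2≤sum⇒ {n} 2≤
... | inj₁ (i , 2≤fi) = inj₁ (suc i , 2≤fi)
... | inj₂ (i , j , i≢j , 1≤fi , 1≤fj) = inj₂ (suc i , suc j , i≢j ∘ Fin.suc-injective , 1≤fi , 1≤fj)

1≤ones⇒ : (P : Matrix ns) → 1 ≤ ones P → ∃[ x ] P x ≡ true
1≤ones⇒ {ns = []} P 1≤ with P [] in eq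
... | true = [] , eq
1≤ones⇒ {ns = n ∷ ns} P 1≤
  with i , 1≤i ← 1≤sum⇒ {n} 1≤
  with x , Px ← 1≤ones⇒ (λ is → P (i ∷ is)) 1≤i = i ∷ x , Px

-- Either one slice holds two ones, or two slices hold one each and the leading coordinate separates
-- them.
2≤ones⇒ : {ns : Vec ℕ d} (P : Matrix ns) → 2 ≤ ones P →
  ∃[ κ ] ∃[ x ] ∃[ y ] P x ≡ true × P y ≡ true × coordinate x κ ≢ coordinate y κ
2≤ones⇒ {ns = []} P 2≤ with P []
2≤ones⇒ {ns = []} P (s≤s ()) | true
2≤ones⇒ {ns = []} P () | false
2≤ones⇒ {ns = n ∷ ns} P 2≤ with 2≤sum⇒ {n} 2≤
... | inj₁ (i , 2≤i) with κ , x , y , Px , Py , x≢y ← 2≤ones⇒ (λ is → P (i ∷ is)) 2≤i =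
  suc κ , i ∷ x , i ∷ y , Px , Py , x≢y
... | inj₂ (i , j , i≢j , 1≤i , 1≤j)
  with x , Px ← 1≤ones⇒ (λ is → P (i ∷ is)) 1≤i | y , Py ← 1≤ones⇒ (λ is → P (j ∷ is)) 1≤j =
  zero , i ∷ x , j ∷ y , Px , Py , i≢j ∘ toℕ-injective

-- Asymptotics

-- `_=O[_^1/_]` raises the constant to the power t; this puts a plain factor below it.
m≤m^[1+s] : ∀ m s → m ≤ m ^ suc s
m≤m^[1+s] zero    s = z≤n
m≤m^[1+s] (suc m) s = m≤m*n (suc m) (suc m ^ s) {{m^n≢0 (suc m) s}}

ex-stack-≤ : ∀ {d} n s {ns : Vec ℕ d} (P : Matrix ns) →
  ex n (stack P (suc s)) ^ suc s ≤ kst-constant (suc s) * (n ^ (d * suc s) + n ^ (d * s + suc s) * ex n P)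
ex-stack-≤ {d} n s P = ex-elim n (stack P (suc s))
  (λ m → m ^ suc s ≤ kst-constant (suc s) * (n ^ (d * suc s) + n ^ (d * s + suc s) * ex n P))
  z≤n (kővári-sós-turán n s P)

stack-upper : ∀ e t → 1 ≤ t → (ns : Vec ℕ (suc e)) (P : Matrix ns) → 2 ≤ ones P →
  (λ n → ex n (stack P t)) =O[ (λ n → ex n P * n ^ ((suc e + 1) * t ∸ suc e)) ^1/ t ]
stack-upper e (suc s) _ ns P 2≤ones = 2 * K , 1 , bound (2≤ones⇒ P 2≤ones)
  where
  open ≤-Reasoning
  t K E : ℕ
  t = suc s
  K = kst-constant t
  E = suc e * s + t
  E≡ : (suc e + 1) * t ∸ suc e ≡ E
  E≡ = trans (cong (_∸ suc e) (lem e s)) (m+n∸m≡n (suc e) E)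
    where
    lem : ∀ e s → (suc e + 1) * suc s ≡ suc e + (suc e * s + suc s)
    lem = solve-∀
  dt≤ : suc e * t ≤ E + e
  dt≤ = subst₂ _≤_ (sym (lem₁ e s)) (sym (lem₂ e s)) (m≤n+m _ s)
    where
    lem₁ : ∀ e s → suc e * suc s ≡ suc e * s + suc e
    lem₁ = solve-∀
    lem₂ : ∀ e s → suc e * s + suc s + e ≡ s + (suc e * s + suc e)
    lem₂ = solve-∀
  bound : (∃[ κ ] ∃[ x ] ∃[ y ] P x ≡ true × P y ≡ true × coordinate x κ ≢ coordinate y κ) →
          ∀ n → 1 ≤ n → ex n (stack P t) ^ t ≤ (2 * K) ^ t * (ex n P * n ^ ((suc e + 1) * t ∸ suc e))
  bound (κ , x , y , Px , Py , x≢y) n 1≤n = begin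
    ex n (stack P t) ^ t                              ≤⟨ ex-stack-≤ n s P ⟩
    K * (n ^ (suc e * t) + n ^ E * ex n P)            ≤⟨ *-monoʳ-≤ K (+-monoˡ-≤ (n ^ E * ex n P) lower) ⟩
    K * (n ^ E * ex n P + n ^ E * ex n P)             ≡⟨ lem K (n ^ E) (ex n P) ⟩
    2 * K * (ex n P * n ^ E)                          ≤⟨ *-monoˡ-≤ (ex n P * n ^ E) (m≤m^[1+s] (2 * K) s) ⟩
    (2 * K) ^ t * (ex n P * n ^ E)                    ≡⟨ cong (λ E → (2 * K) ^ t * (ex n P * n ^ E)) E≡ ⟨
    (2 * K) ^ t * (ex n P * n ^ ((suc e + 1) * t ∸ suc e)) ∎
    where
    instance _ = >-nonZero 1≤n
    lem : ∀ K m x → K * (m * x + m * x) ≡ 2 * K * (x * m)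
    lem = solve-∀
    -- With d = `suc e`, the bound ex(n,P) ≥ n^(d-1) absorbs the error term n^(dt), because d t ≤ E
    -- + (d - 1).
    lower : n ^ (suc e * t) ≤ n ^ E * ex n P
    lower = begin
      n ^ (suc e * t)       ≤⟨ ^-monoʳ-≤ n dt≤ ⟩
      n ^ (E + e)           ≡⟨ ^-distribˡ-+-* n E e ⟩
      n ^ E * n ^ e         ≤⟨ *-monoʳ-≤ (n ^ E) (n^d≤ex P n 1≤n κ x y Px Py x≢y) ⟩
      n ^ E * ex n P        ∎

stack-upper-linear : ∀ e t → 1 ≤ t → (ns : Vec ℕ (suc e)) (P : Matrix ns) →
  (λ n → ex n P) =O (λ n → n ^ e) →
  (λ n → ex n (stack P t)) =O[ (λ n → n ^ ((suc e + 1) * t ∸ 1)) ^1/ t ]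
-- The extra 1 in `suc C₀` pays for the error term n^(dt) ≤ n^E; `suc N₀` ensures n ≥ 1, so that
-- powers of n increase with the exponent.
stack-upper-linear e (suc s) _ ns P (C₀ , N₀ , exP≤) = K * suc C₀ , suc N₀ , bound
  where
  open ≤-Reasoning
  t K E : ℕ
  t = suc s
  K = kst-constant t
  E = suc e * s + t + e
  E≡ : (suc e + 1) * t ∸ 1 ≡ E
  E≡ = cong (_∸ 1) (lem e s)
    where
    lem : ∀ e s → (suc e + 1) * suc s ≡ suc (suc e * s + suc s + e)
    lem = solve-∀
  dt≤ : suc e * t ≤ E
  dt≤ = subst₂ _≤_ (sym (lem₁ e s)) (sym (lem₂ e s)) (m≤n+m _ s)
    where
    lem₁ : ∀ e s → suc e * suc s ≡ suc e * s + suc e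
    lem₁ = solve-∀
    lem₂ : ∀ e s → suc e * s + suc s + e ≡ s + (suc e * s + suc e)
    lem₂ = solve-∀
  bound : ∀ n → suc N₀ ≤ n → ex n (stack P t) ^ t ≤ (K * suc C₀) ^ t * n ^ ((suc e + 1) * t ∸ 1)
  bound n N₀<n = begin
    ex n (stack P t) ^ t                                    ≤⟨ ex-stack-≤ n s P ⟩
    K * (n ^ (suc e * t) + n ^ (suc e * s + t) * ex n P)
      ≤⟨ *-monoʳ-≤ K (+-mono-≤ (^-monoʳ-≤ n dt≤) (*-monoʳ-≤ (n ^ (suc e * s + t)) (exP≤ n (<⇒≤ N₀<n)))) ⟩
    K * (n ^ E + n ^ (suc e * s + t) * (C₀ * n ^ e))
      ≡⟨ cong (λ m → K * (m + n ^ (suc e * s + t) * (C₀ * n ^ e))) (^-distribˡ-+-* n (suc e * s + t) e) ⟩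
    K * (n ^ (suc e * s + t) * n ^ e + n ^ (suc e * s + t) * (C₀ * n ^ e)) ≡⟨ lem K C₀ (n ^ (suc e * s + t)) (n ^ e) ⟩
    K * suc C₀ * (n ^ (suc e * s + t) * n ^ e)
      ≡⟨ cong (K * suc C₀ *_) (^-distribˡ-+-* n (suc e * s + t) e) ⟨
    K * suc C₀ * n ^ E                                      ≤⟨ *-monoˡ-≤ (n ^ E) (m≤m^[1+s] (K * suc C₀) s) ⟩
    (K * suc C₀) ^ t * n ^ E                                ≡⟨ cong (λ E → (K * suc C₀) ^ t * n ^ E) E≡ ⟨
    (K * suc C₀) ^ t * n ^ ((suc e + 1) * t ∸ 1)            ∎
    where
    instance _ = >-nonZero (≤-trans (s≤s z≤n) N₀<n)
    lem : ∀ K C a b → K * (a * b + a * (C * b)) ≡ K * suc C * (a * b)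
    lem = solve-∀

floorLog : ∀ b → 2 ≤ b → ∀ n → 1 ≤ n → ∃[ k ] b ^ k ≤ n × n < b ^ suc k
floorLog b 2≤b (suc zero) _ = 0 , ≤-refl , subst (1 <_) (sym (*-identityʳ b)) 2≤b
floorLog b 2≤b (suc (suc n)) _ with floorLog b 2≤b (suc n) (s≤s z≤n)
... | k , b^k≤ , <b^k+1 with suc (suc n) <? b ^ suc k
...   | yes lt = k , m≤n⇒m≤1+n b^k≤ , lt
...   | no ¬lt = suc k , ≮⇒≥ ¬lt , ≤-<-trans <b^k+1 (^-monoʳ-< b 2≤b (n<1+n (suc k)))

-- 4^t is the gap between powers of 4^t around n, 8^t the loss from 4^k < 8 p.
scaleConstant : ℕ → ℕ
scaleConstant t = 4 ^ t * 8 ^ t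

-- Choose k with 4^(kt) ≤ n < 4^((k+1)t) and a prime p in (4^k / 8, 4^k]. The threshold gives k ≥
-- 10.
primeScale : ∀ t → 1 ≤ t → ∀ n → (4 ^ t) ^ 10 ≤ n →
  ∃[ p ] Prime p × p ≢ 2 × p ^ t ≤ n × n ≤ scaleConstant t * p ^ t
primeScale t@(suc _) 1≤t n N≤n = scaled (floorLog b 2≤b n (≤-trans (m^n>0 b {{b≢0}} 10) N≤n))
  where
  b : ℕ
  b = 4 ^ t
  b≢0 : NonZero b
  b≢0 = m^n≢0 4 t
  2≤b : 2 ≤ b
  2≤b = ≤-trans (s≤s (s≤s z≤n)) (m≤m*n 4 (4 ^ pred t) {{m^n≢0 4 (pred t)}})
  scaled : ∃[ k ] b ^ k ≤ n × n < b ^ suc k → ∃[ p ] Prime p × p ≢ 2 × p ^ t ≤ n × n ≤ scaleConstant t * p ^ t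
  scaled (k , b^k≤n , n<b^k+1) = primeOf (primeBetween k 10≤k)
    where
    open ≤-Reasoning
    10≤k : 10 ≤ k
    10≤k with 10 ≤? k
    ... | yes p = p
    ... | no ¬p = ⊥-elim (<⇒≱ (<-≤-trans n<b^k+1 (^-monoʳ-≤ b {{b≢0}} (≰⇒> ¬p))) N≤n)
    b^k≡ : b ^ k ≡ (4 ^ k) ^ t
    b^k≡ = trans (^-*-assoc 4 t k) (trans (cong (4 ^_) (*-comm t k)) (sym (^-*-assoc 4 k t)))
    primeOf : ∃[ p ] Prime p × 4 ^ k < 8 * p × p ≤ 4 ^ k →
      ∃[ p ] Prime p × p ≢ 2 × p ^ t ≤ n × n ≤ scaleConstant t * p ^ t
    primeOf (p , p-prime , 4^k<8p , p≤4^k) =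
      p , p-prime , p≢2 , ≤-trans (^-monoˡ-≤ t p≤4^k) (subst (_≤ n) b^k≡ b^k≤n) , (begin
        n                           ≤⟨ <⇒≤ n<b^k+1 ⟩
        b * b ^ k                   ≡⟨ cong (b *_) b^k≡ ⟩
        b * (4 ^ k) ^ t             ≤⟨ *-monoʳ-≤ b (^-monoˡ-≤ t (<⇒≤ 4^k<8p)) ⟩
        b * (8 * p) ^ t             ≡⟨ cong (b *_) (^-distribʳ-* t 8 p) ⟩
        b * (8 ^ t * p ^ t)         ≡⟨ *-assoc b (8 ^ t) (p ^ t) ⟨
        scaleConstant t * p ^ t     ∎)
      where
      p≢2 : p ≢ 2
      -- 8 · 2 = 4² ≤ 4^k.
      p≢2 refl = <⇒≱ 4^k<8p (≤-trans (^-monoʳ-≤ 4 {2} {10} (s≤s (s≤s z≤n))) (^-monoʳ-≤ 4 10≤k))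

-- With p² of order n, n^e p³ ones are of order n^(e+3/2) = n^(d+1/2) for d = `suc e`.
stack₂-lower : ∀ e (ns : Vec ℕ (suc e)) (P : Matrix ns) → 2 ≤ ones P →
  (λ n → ex n (stack P 2)) =Ω[ (λ n → n ^ (suc e * 2 + 1)) ^1/ 2 ]
stack₂-lower e ns P 2≤ones = B ^ 3 , (4 ^ 2) ^ 10 , λ n N≤n →
  bound (2≤ones⇒ P 2≤ones) n (primeScale 2 (s≤s z≤n) n N≤n)
  where
  open ≤-Reasoning
  B : ℕ
  B = scaleConstant 2
  bound : (∃[ κ ] ∃[ x ] ∃[ y ] P x ≡ true × P y ≡ true × coordinate x κ ≢ coordinate y κ) → ∀ n →
    ∃[ p ] Prime p × p ≢ 2 × p ^ 2 ≤ n × n ≤ B * p ^ 2 → n ^ (suc e * 2 + 1) ≤ (B ^ 3) ^ 2 * ex n (stack P 2) ^ 2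
  bound (κ , x , y , Px , Py , x≢y) n (p , p-prime , _ , p²≤n , n≤) = begin
    n ^ (suc e * 2 + 1)                         ≡⟨ cong (n ^_) (lem₁ e) ⟩
    n ^ (e * 2 + 3)                             ≡⟨ ^-distribˡ-+-* n (e * 2) 3 ⟩
    n ^ (e * 2) * n ^ 3                         ≤⟨ *-monoʳ-≤ (n ^ (e * 2)) (^-monoˡ-≤ 3 n≤) ⟩
    n ^ (e * 2) * (B * p ^ 2) ^ 3               ≡⟨ cong₂ _*_ (sym (^-*-assoc n e 2)) (^-distribʳ-* 3 B (p ^ 2)) ⟩
    (n ^ e) ^ 2 * (B ^ 3 * (p ^ 2) ^ 3)         ≡⟨ cong (λ m → (n ^ e) ^ 2 * (B ^ 3 * m)) p⁶≡ ⟩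
    (n ^ e) ^ 2 * (B ^ 3 * (p ^ 3) ^ 2)         ≡⟨ lem₂ (n ^ e) (B ^ 3) (p ^ 3) ⟩
    B ^ 3 * (n ^ e * p ^ 3) ^ 2                 ≤⟨ *-mono-≤ (m≤m^[1+s] (B ^ 3) 1) (^-monoˡ-≤ 2 ones≤) ⟩
    (B ^ 3) ^ 2 * ex n (stack P 2) ^ 2          ∎
    where
    open LineGraph p p-prime
    lem₁ : ∀ e → suc e * 2 + 1 ≡ e * 2 + 3
    lem₁ = solve-∀
    swap : ∀ a b c → a * (b * c) ≡ b * (a * c)
    swap = solve-∀
    lem₂ : ∀ m b c → m ^ 2 * (b * c ^ 2) ≡ b * (m * c) ^ 2
    lem₂ m b c = trans (swap (m ^ 2) b (c ^ 2)) (cong (b *_) (sym (^-distribʳ-* 2 m c)))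
    p⁶≡ : (p ^ 2) ^ 3 ≡ (p ^ 3) ^ 2
    p⁶≡ = trans (^-*-assoc p 2 3) (sym (^-*-assoc p 3 2))
    xs : Fin 2 → Index ns
    xs 0F = x
    xs 1F = y
    Pxs : ∀ i → P (xs i) ≡ true
    Pxs 0F = Px
    Pxs 1F = Py
    xs-inj : ∀ {i j} → coordinate (xs i) κ ≡ coordinate (xs j) κ → i ≡ j
    xs-inj {0F} {0F} _  = refl
    xs-inj {0F} {1F} eq = ⊥-elim (x≢y eq)
    xs-inj {1F} {0F} eq = ⊥-elim (x≢y (sym eq))
    xs-inj {1F} {1F} _  = refl
    ones≤ : n ^ e * p ^ 3 ≤ ex n (stack P 2)
    ones≤ = ≤-trans (*-monoʳ-≤ (n ^ e) (lineMatrix-ones n (subst (_≤ n) (cong (p *_) (*-identityʳ p)) p²≤n)))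
                    (cylinder-≤-ex P n κ xs Pxs xs-inj lineMatrix lineMatrix-KFree)

stack₃-lower : ∀ e (ns : Vec ℕ (suc e)) (P : Matrix ns) →
  (∃[ x ] ∃[ y ] ∃[ z ]
    P x ≡ true × P y ≡ true × P z ≡ true ×
    firstCoordinate x ≢ firstCoordinate y ×
    firstCoordinate y ≢ firstCoordinate z ×
    firstCoordinate x ≢ firstCoordinate z) →
  (λ n → ex n (stack P 3)) =Ω[ (λ n → n ^ (suc e * 3 + 2)) ^1/ 3 ]
stack₃-lower e (m ∷ ns) P (x@(x₀ ∷ _) , y@(y₀ ∷ _) , z@(z₀ ∷ _) , Px , Py , Pz , x≢y , y≢z , x≢z) =
  -- B⁵ comes from n⁵ ≤ (B p³)⁵, and 64 = 4³ from p⁵ ≤ 4 p³ (p - 1)².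
  B ^ 5 * 64 , (4 ^ 3) ^ 10 , λ n N≤n → bound n (primeScale 3 (s≤s z≤n) n N≤n)
  where
  open ≤-Reasoning
  B : ℕ
  B = scaleConstant 3
  xs : Fin 3 → Index (m ∷ ns)
  xs 0F = x
  xs 1F = y
  xs 2F = z
  Pxs : ∀ i → P (xs i) ≡ true
  Pxs 0F = Px
  Pxs 1F = Py
  Pxs 2F = Pz
  xs-inj : ∀ {i j} → coordinate (xs i) zero ≡ coordinate (xs j) zero → i ≡ j
  xs-inj {0F} {0F} _  = refl
  xs-inj {0F} {1F} eq = ⊥-elim (x≢y (toℕ-injective eq))
  xs-inj {0F} {2F} eq = ⊥-elim (x≢z (toℕ-injective eq))
  xs-inj {1F} {0F} eq = ⊥-elim (x≢y (toℕ-injective (sym eq)))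
  xs-inj {1F} {1F} _  = refl
  xs-inj {1F} {2F} eq = ⊥-elim (y≢z (toℕ-injective eq))
  xs-inj {2F} {0F} eq = ⊥-elim (x≢z (toℕ-injective (sym eq)))
  xs-inj {2F} {1F} eq = ⊥-elim (y≢z (toℕ-injective (sym eq)))
  xs-inj {2F} {2F} _  = refl
  bound : ∀ n → ∃[ p ] Prime p × p ≢ 2 × p ^ 3 ≤ n × n ≤ B * p ^ 3 →
          n ^ (suc e * 3 + 2) ≤ (B ^ 5 * 64) ^ 3 * ex n (stack P 3) ^ 3
  bound n (p , p-prime , p≢2 , p³≤n , n≤) = begin
    n ^ (suc e * 3 + 2)                             ≡⟨ cong (n ^_) (lem₁ e) ⟩
    n ^ (e * 3 + 5)                                 ≡⟨ ^-distribˡ-+-* n (e * 3) 5 ⟩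
    n ^ (e * 3) * n ^ 5                             ≤⟨ *-monoʳ-≤ (n ^ (e * 3)) (^-monoˡ-≤ 5 n≤) ⟩
    n ^ (e * 3) * (B * p ^ 3) ^ 5                   ≡⟨ cong₂ _*_ (sym (^-*-assoc n e 3)) (^-distribʳ-* 5 B (p ^ 3)) ⟩
    (n ^ e) ^ 3 * (B ^ 5 * (p ^ 3) ^ 5)             ≡⟨ cong (λ m → (n ^ e) ^ 3 * (B ^ 5 * m)) p¹⁵≡ ⟩
    (n ^ e) ^ 3 * (B ^ 5 * (p ^ 5) ^ 3)             ≤⟨ *-monoʳ-≤ ((n ^ e) ^ 3) (*-monoʳ-≤ (B ^ 5) (^-monoˡ-≤ 3 p⁵≤)) ⟩
    (n ^ e) ^ 3 * (B ^ 5 * (4 * c) ^ 3)             ≡⟨ lem₂ (n ^ e) (B ^ 5) c ⟩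
    B ^ 5 * 64 * (n ^ e * c) ^ 3                    ≤⟨ *-mono-≤ (m≤m^[1+s] (B ^ 5 * 64) 2) (^-monoˡ-≤ 3 ones≤) ⟩
    (B ^ 5 * 64) ^ 3 * ex n (stack P 3) ^ 3         ∎
    where
    open NormMatrix p p-prime p≢2
    c : ℕ
    c = p * (p * ((p ∸ 1) * ((p ∸ 1) * (p * 1))))
    lem₁ : ∀ e → suc e * 3 + 2 ≡ e * 3 + 5
    lem₁ = solve-∀
    swap : ∀ a b c k → a * (b * (k * c)) ≡ b * k * (a * c)
    swap = solve-∀
    lem₂ : ∀ m b c → m ^ 3 * (b * (4 * c) ^ 3) ≡ b * 64 * (m * c) ^ 3
    lem₂ m b c = trans (cong (λ k → m ^ 3 * (b * k)) (^-distribʳ-* 3 4 c))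
                   (trans (swap (m ^ 3) b (c ^ 3) 64) (cong (b * 64 *_) (sym (^-distribʳ-* 3 m c))))
    p¹⁵≡ : (p ^ 3) ^ 5 ≡ (p ^ 5) ^ 3
    p¹⁵≡ = trans (^-*-assoc p 3 5) (sym (^-*-assoc p 5 3))
    p≤2[p∸1] : p ≤ 2 * (p ∸ 1)
    p≤2[p∸1] = half p (nonTrivial⇒n>1 p {{prime⇒nonTrivial p-prime}})
      where
      half : ∀ p → 1 < p → p ≤ 2 * (p ∸ 1)
      half (suc q) (s≤s 1≤q) = subst (suc q ≤_) (cong (q +_) (sym (+-identityʳ q))) (+-monoˡ-≤ q 1≤q)
    p⁵≤ : p ^ 5 ≤ 4 * c
    p⁵≤ = begin
      p ^ 5                                             ≡⟨ lem₃ p ⟩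
      p * p * p * (p * p)                               ≤⟨ *-monoʳ-≤ (p * p * p) (*-mono-≤ p≤2[p∸1] p≤2[p∸1]) ⟩
      p * p * p * (2 * (p ∸ 1) * (2 * (p ∸ 1)))         ≡⟨ lem₄ p (p ∸ 1) ⟩
      4 * c                                             ∎
      where
      lem₃ : ∀ p → p * (p * (p * (p * (p * 1)))) ≡ p * p * p * (p * p)
      lem₃ = solve-∀
      lem₄ : ∀ p q → p * p * p * (2 * q * (2 * q)) ≡ 4 * (p * (p * (q * (q * (p * 1)))))
      lem₄ = solve-∀
    ones≤ : n ^ e * c ≤ ex n (stack P 3)
    ones≤ = ≤-trans (*-monoʳ-≤ (n ^ e) (normMatrix-ones n (subst (_≤ n) (lem₃ p) p³≤n)))
                    (cylinder-≤-ex P n zero xs Pxs xs-inj normMatrix normMatrix-KFree)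
      where
      lem₃ : ∀ p → p * (p * (p * 1)) ≡ p * p * p
      lem₃ = solve-∀

theorem3p1 : (d-1 : ℕ) → let d = suc d-1 in
    ((t : ℕ) → 1 ≤ t → (ns : Vec ℕ d) (P : Matrix ns) → 2 ≤ ones P →
    (λ n → ex n (stack P t)) =O[ (λ n → ex n P * n ^ ((d + 1) * t ∸ d)) ^1/ t ])
    ×
    ((t : ℕ) → 1 ≤ t → (ns : Vec ℕ d) (P : Matrix ns) →
    (λ n → ex n P) =O (λ n → n ^ (d ∸ 1)) →
    (λ n → ex n (stack P t)) =O[ (λ n → n ^ ((d + 1) * t ∸ 1)) ^1/ t ])
    ×
    ((ns : Vec ℕ d) (P : Matrix ns) → 2 ≤ ones P →
    (λ n → ex n P) =O (λ n → n ^ (d ∸ 1)) →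
    (λ n → ex n (stack P 2)) =Θ[ (λ n → n ^ (d * 2 + 1)) ^1/ 2 ])
    ×
    ((ns : Vec ℕ d) (P : Matrix ns) →
    (∃[ x ] ∃[ y ] ∃[ z ]
    P x ≡ true × P y ≡ true × P z ≡ true ×
    firstCoordinate x ≢ firstCoordinate y ×
    firstCoordinate y ≢ firstCoordinate z ×
    firstCoordinate x ≢ firstCoordinate z) →
    (λ n → ex n P) =O (λ n → n ^ (d ∸ 1)) →
    (λ n → ex n (stack P 3)) =Θ[ (λ n → n ^ (d * 3 + 2)) ^1/ 3 ])
theorem3p1 e =
    stack-upper e
  , stack-upper-linear e
  , (λ ns P 2≤ones exP →
      subst (λ E → (λ n → ex n (stack P 2)) =O[ (λ n → n ^ E) ^1/ 2 ]) (cong (_∸ 1) (lem₂ e))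
        (stack-upper-linear e 2 (s≤s z≤n) ns P exP)
      , stack₂-lower e ns P 2≤ones)
  , (λ ns P points exP →
      subst (λ E → (λ n → ex n (stack P 3)) =O[ (λ n → n ^ E) ^1/ 3 ]) (cong (_∸ 1) (lem₃ e))
        (stack-upper-linear e 3 (s≤s z≤n) ns P exP)
      , stack₃-lower e ns P points)
  where
  lem₂ : ∀ e → (suc e + 1) * 2 ≡ suc (suc e * 2 + 1)
  lem₂ = solve-∀
  lem₃ : ∀ e → (suc e + 1) * 3 ≡ suc (suc e * 3 + 2)
  lem₃ = solve-∀
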